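{- Let $q$ be a prime power, $\sigma$ a generator of $\mathrm{Gal}(\mathbb{F}_{q^5}/\mathbb{F}_q)$, and $L=ax+bx^{\sigma}+cx^{\sigma^2}+dx^{\sigma^3}$ with $a,b,c,d\in\mathbb{F}_{q^5}$ and $abcd\neq0$. Let $w=\frac{a^\sigma c}{b^{\sigma+1}}$ and $z=\frac{b^\sigma d}{c^{\sigma+1}}$. Then $P_L(y)=a+by+cy^{\sigma+1}+dy^{\sigma^2+\sigma+1}$ has $q^2+q+1$ roots in $\mathbb{F}_{q^5}$ if and only if $z^{\sigma^2+1}+z^{\sigma}-1=0$ and $z^{\sigma}+z-1-w^{\sigma}z^{1+\sigma}=0$. Also, $L$ has $q^3$ roots in $\mathbb{F}_{q^5}$ if and only if $z^{\sigma^2+1}+z^{\sigma}-1=0$, $z^{\sigma}+z-1-w^{\sigma}z^{1+\sigma}=0$, and $N(z)N(c/d)=-1$.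
   Context: $N(x)=x^{1+\sigma+\sigma^2+\sigma^3+\sigma^4}$ is the norm $\mathbb{F}_{q^5}\to\mathbb{F}_q$. -}

module Defs where

open import Data.Nat using (ℕ; zero; suc)
open import Data.Fin using (Fin)
open import Data.List using (List; length; filter; allFin)
open import Relation.Nullary using (¬_)
open import Relation.Binary.PropositionalEquality using (_≡_)
open import Relation.Binary.Definitions using (DecidableEquality)
open import Algebra.Core using (Op₁; Op₂)
open import Algebra.Structures using (IsCommutativeRing)
open import Function.Bundles using (_↔_; Inverse)

-- A finite field: a commutative ring (with propositional equality) in which
-- 0 ≠ 1 and every nonzero element has an inverse, together with an explicit
-- enumeration of its elements by Fin size (so size = number of elements).
-- The inverse is a total operation; its value at 0 is irrelevant.
record FiniteField : Set₁ where
  infixl 7 _⊗_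
  infixl 6 _⊕_
  field
    Carrier    : Set
    _⊕_ _⊗_    : Op₂ Carrier
    ⊖_         : Op₁ Carrier
    0# 1#      : Carrier
    _⁻¹        : Op₁ Carrier
    isCommutativeRing : IsCommutativeRing _≡_ _⊕_ _⊗_ ⊖_ 0# 1#
    0≢1        : ¬ (0# ≡ 1#)
    ⁻¹-inverse : ∀ x → ¬ (x ≡ 0#) → x ⊗ (x ⁻¹) ≡ 1#
    _≟_        : DecidableEquality Carrier
    size       : ℕ
    enum       : Fin size ↔ Carrier

  infixr 8 _**_
  _**_ : Carrier → ℕ → Carrier
  x ** zero  = 1#
  x ** suc n = x ⊗ (x ** n)

  _/_ : Carrier → Carrier → Carrier
  x / y = x ⊗ (y ⁻¹)

  numRoots : (Carrier → Carrier) → ℕ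
  numRoots f = length (filter (λ i → f (Inverse.to enum i) ≟ 0#) (allFin size))

-- View L as a polynomial in the skew ring K[X;σ], K = F_{q⁵}, and divide X⁵ by it on the right.
-- The X- and X²-coefficients of the remainder vanish exactly when E₁ and E₂ hold, and then the
-- remainder is the constant -N(z)N(c/d).  A nonzero skew polynomial of degree n has at most qⁿ
-- zeros on K, and a right divisor of degree n of X⁵ - 1, which kills K, attains this bound.
-- Hence L has q³ zeros iff the remainder is 1.  For P use the operators θσ instead of σ:
-- by Hilbert 90, x ↦ θ σ(x)/x maps the nonzero zeros of L(θσ) onto the roots of P of norm N(θ),
-- with fibres of size q - 1.  If the remainder is a constant, it is a norm N(θ), all roots of P
-- have this norm, and there are (q³-1)/(q-1) of them.  If it is not, the roots of each norm are
-- roots of a nonzero quadratic, so there are at most (q-1)(q+1) roots in all.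
module Submission where

open import Defs
open import Level using (0ℓ)
open import Data.Bool.Base using (if_then_else_)
open import Data.Nat as ℕ using (ℕ; zero; suc; _+_; _*_; _^_; _≤_; _<_; z≤n; s≤s)
open import Data.Nat.Properties as ℕ using ()
open import Data.Nat.Combinatorics using (_C_; nCn≡1; nC1≡n; nCk+nC[k+1]≡[n+1]C[k+1])
open import Data.Nat.Divisibility using (_∣_; divides; m∣m*n; ∣⇒≤)
open import Data.Nat.Primality using (Prime; euclidsLemma; prime⇒nonTrivial; prime⇒nonZero)
open import Data.Nat.Solver using (module +-*-Solver)
open import Data.Integer as ℤ using (ℤ; +_; -[1+_])
open import Data.Integer.Properties as ℤ using ()
open import Data.Fin using (Fin; zero; suc; toℕ; fromℕ)
open import Data.Fin.Permutation using (Permutation; permutation)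
open import Data.Fin.Properties as Fin using ()
open import Data.List using (length; filter; tabulate)
open import Data.Maybe using (Maybe; nothing; just)
open import Data.Product using (∃; _×_; _,_; proj₁; proj₂)
open import Data.Sum using (inj₁; inj₂)
open import Data.Vec using (Vec; []; _∷_; map)
open import Data.Vec.Relation.Unary.All using (All; []; _∷_; all?)
open import Function using (_∘_; id)
open import Function.Bundles using (_⇔_; mk⇔; Equivalence; Inverse)
open import Relation.Nullary using (¬_; Dec; yes; no; does; contradiction; ¬?)
open import Relation.Nullary.Decidable using (_×-dec_; dec-true; dec-false; map′)
open import Relation.Unary using (Pred; Decidable)
open import Relation.Binary.PropositionalEquality using (_≡_; _≢_; refl; sym; trans; cong; cong₂; subst; module ≡-Reasoning)
open import Algebra.Bundles using (CommutativeMonoid; CommutativeRing)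
open import Algebra.Structures using (IsCommutativeRing)
open import Algebra.Solver.Ring.AlmostCommutativeRing using (fromCommutativeRing; _-Raw-AlmostCommutative⟶_)
open import Algebra.Properties.Semiring.Sum ℕ.+-*-semiring
  using (sum; sum-cong-≗; ∑-comm; ∑-distrib-+; *-distribʳ-sum; *-distribˡ-sum; sum-replicate-zero)
import Algebra.Properties.CommutativeMonoid.Sum
import Algebra.Properties.CommutativeSemiring.Binomial
import Algebra.Properties.Ring
import Algebra.Properties.Semiring.Exp
import Algebra.Properties.Semiring.Mult
import Algebra.Properties.Semiring.Mult.TCOptimised
import Algebra.Solver.Ring

-- Kernels and root sets are counted, in place of dimensions. An additive map has no fibre larger
-- than its kernel, so if m after f vanishes on K, then |K| ≤ |ker m| |ker f|, and the upper bound
-- q^deg for m becomes a lower bound for f. This is how right divisors of X⁵ - c get full kernels.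
-- The zeros of L see only the roots of P of norm 1. The twists θσ reach the other norms: each obeys
-- the same rule X a = σ(a) X, so one formal division by the cubic serves every θ, while X⁵ acts as
-- the scalar N(θ) instead of 1. Thus X⁵ - N(θ) takes the place of X⁵ - 1. A suitable θ is always
-- explicit: either a root of P, or -z c/d, whose norm is -N(z)N(c/d) because 5 is odd. L and P are
-- divided by d, which changes neither their zeros nor z and w. The remainder of X⁵ contains b/d
-- unshifted, while z expresses σ(b/d) directly; hence some coefficients are compared only after
-- applying σ or σ².

indicator : ∀ {A : Set} → Dec A → ℕ
indicator d = if does d then 1 else 0

indicator-mono : ∀ {A B : Set} (d : Dec A) (e : Dec B) → (A → B) → indicator d ≤ indicator e
indicator-mono (no _)  e       f = z≤n
indicator-mono (yes a) (yes b) f = ℕ.≤-refl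
indicator-mono (yes a) (no ¬b) f = contradiction (f a) ¬b

indicator-× : ∀ {A B : Set} (d : Dec A) (e : Dec B) → indicator (d ×-dec e) ≡ indicator d * indicator e
indicator-× (no _)  e       = refl
indicator-× (yes _) (yes _) = refl
indicator-× (yes _) (no _)  = refl

sum-mono : ∀ {n} {f g : Fin n → ℕ} → (∀ i → f i ≤ g i) → sum f ≤ sum g
sum-mono {zero}  f≤g = z≤n
sum-mono {suc n} f≤g = ℕ.+-mono-≤ (f≤g zero) (sum-mono (f≤g ∘ suc))

sum-1 : ∀ n → sum {n} (λ _ → 1) ≡ n
sum-1 zero    = refl
sum-1 (suc n) = cong suc (sum-1 n)

sum-indicator-≡ : ∀ {n} (i : Fin n) → sum (λ j → indicator (i Fin.≟ j)) ≡ 1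
sum-indicator-≡ {suc n} zero    = cong suc (sum-replicate-zero n)
sum-indicator-≡ {suc n} (suc i) = trans (sum-cong-≗ (λ j → step i j)) (sum-indicator-≡ i)
  where
  step : ∀ {n} (i j : Fin n) → indicator (suc i Fin.≟ suc j) ≡ indicator (i Fin.≟ j)
  step i j = ℕ.≤-antisym (indicator-mono (suc i Fin.≟ suc j) (i Fin.≟ j) Fin.suc-injective)
                         (indicator-mono (i Fin.≟ j) (suc i Fin.≟ suc j) (cong suc))

length-filter-tabulate : ∀ {n} {B : Set} {P : Pred B 0ℓ} (P? : Decidable P) (f : Fin n → B) →
  length (filter P? (tabulate f)) ≡ sum (λ i → indicator (P? (f i)))
length-filter-tabulate {zero}  P? f = refl
length-filter-tabulate {suc n} P? f with P? (f zero)
... | yes _ = cong suc (length-filter-tabulate P? (f ∘ suc))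
... | no _  = length-filter-tabulate P? (f ∘ suc)

-- Counting subsets of a finite field by fibres

module Counting (F : FiniteField) where
  open FiniteField F
  open Inverse enum using (to; from; inverseˡ; inverseʳ)

  private variable A B : Pred Carrier 0ℓ

  to∘from : ∀ x → to (from x) ≡ x
  to∘from x = inverseˡ refl

  from∘to : ∀ i → from (to i) ≡ i
  from∘to i = inverseʳ refl

  count : Decidable A → ℕ
  count A? = sum (λ i → indicator (A? (to i)))

  numRoots≡count : ∀ f → numRoots f ≡ count (λ x → f x ≟ 0#)
  numRoots≡count f = length-filter-tabulate (λ i → f (to i) ≟ 0#) id

  count-mono : (A? : Decidable A) (B? : Decidable B) → (∀ x → A x → B x) → count A? ≤ count B?
  count-mono A? B? A⊆B = sum-mono (λ i → indicator-mono (A? (to i)) (B? (to i)) (A⊆B (to i)))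

  count-cong : (A? : Decidable A) (B? : Decidable B) →
    (∀ x → A x → B x) → (∀ x → B x → A x) → count A? ≡ count B?
  count-cong A? B? A⊆B B⊆A = ℕ.≤-antisym (count-mono A? B? A⊆B) (count-mono B? A? B⊆A)

  count-all : (A? : Decidable A) → (∀ x → A x) → count A? ≡ size
  count-all A? all = trans (sum-cong-≗ (λ i → cong (if_then 1 else 0) (dec-true (A? (to i)) (all (to i))))) (sum-1 size)

  count-≡ : ∀ x → count (x ≟_) ≡ 1
  count-≡ x = trans (sum-cong-≗ step) (sum-indicator-≡ (from x))
    where
    step : ∀ i → indicator (x ≟ to i) ≡ indicator (from x Fin.≟ i)
    step i = ℕ.≤-antisym
      (indicator-mono (x ≟ to i) (from x Fin.≟ i) (λ { refl → from∘to i }))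
      (indicator-mono (from x Fin.≟ i) (x ≟ to i) (λ { refl → sym (to∘from x) }))

  search : Decidable A → Dec (∃ A)
  search {A} A? = map′ (λ (i , p) → to i , p) (λ (x , p) → from x , subst A (sym (to∘from x)) p) (Fin.any? (A? ∘ to))

  count-subsingleton : (A? : Decidable A) → (∀ x y → A x → A y → x ≡ y) → count A? ≤ 1
  count-subsingleton A? unique with search A?
  ... | yes (x , p) = ℕ.≤-trans (count-mono A? (x ≟_) (λ y → unique x y p)) (ℕ.≤-reflexive (count-≡ x))
  ... | no none     = ℕ.≤-trans (count-mono A? (0# ≟_) (λ y p → contradiction (y , p) none)) (ℕ.≤-reflexive (count-≡ 0#))

  -- Later used to set aside 0, the one kernel element with no slope, and to set aside a known root.
  count-split : (A? : Decidable A) (x : Carrier) → A x →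
    count A? ≡ suc (count (λ y → ¬? (x ≟ y) ×-dec A? y))
  count-split {A} A? x Ax = begin
    count A?                                                   ≡⟨ sum-cong-≗ (λ i → step (to i)) ⟩
    sum (λ i → indicator (x ≟ to i) + indicator (¬? (x ≟ to i) ×-dec A? (to i)))
      ≡⟨ ∑-distrib-+ (λ i → indicator (x ≟ to i)) (λ i → indicator (¬? (x ≟ to i) ×-dec A? (to i))) ⟩
    count (x ≟_) + count (λ y → ¬? (x ≟ y) ×-dec A? y)
      ≡⟨ cong (_+ count (λ y → ¬? (x ≟ y) ×-dec A? y)) (count-≡ x) ⟩
    suc (count (λ y → ¬? (x ≟ y) ×-dec A? y))                   ∎
    where
    open ≡-Reasoning
    step : ∀ y → indicator (A? y) ≡ indicator (x ≟ y) + indicator (¬? (x ≟ y) ×-dec A? y)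
    step y with x ≟ y
    ... | yes refl = cong (if_then 1 else 0) (dec-true (A? x) Ax)
    ... | no _     = refl

  module _ (A? : Decidable A) (f : Carrier → Carrier) where

    count-fibre : Carrier → ℕ
    count-fibre b = count (λ x → A? x ×-dec (f x ≟ b))

    -- Double counting: each `x` in `A` meets exactly one fibre, and the two sums are interchanged.
    count-by-fibres : count A? ≡ sum (λ j → count-fibre (to j))
    count-by-fibres = trans (sum-cong-≗ (λ i → sym (step (to i)))) (∑-comm {size} {size} (λ i j → indicator (A? (to i) ×-dec (f (to i) ≟ to j))))
      where
      open ≡-Reasoning
      step : ∀ x → sum (λ j → indicator (A? x ×-dec (f x ≟ to j))) ≡ indicator (A? x)
      step x = begin
        sum (λ j → indicator (A? x ×-dec (f x ≟ to j)))      ≡⟨ sum-cong-≗ (λ j → indicator-× (A? x) (f x ≟ to j)) ⟩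
        sum (λ j → indicator (A? x) * indicator (f x ≟ to j))
          ≡⟨ *-distribˡ-sum (indicator (A? x)) (λ j → indicator (f x ≟ to j)) ⟨
        indicator (A? x) * count (f x ≟_)                     ≡⟨ cong (indicator (A? x) *_) (count-≡ (f x)) ⟩
        indicator (A? x) * 1                                  ≡⟨ ℕ.*-identityʳ _ ⟩
        indicator (A? x)                                      ∎

    module _ (B? : Decidable B) (m : ℕ) where

      count-fibre-≤ : (∀ x → A x → B (f x)) → (∀ b → B b → count-fibre b ≤ m) → count A? ≤ count B? * m
      count-fibre-≤ f∈B bound = begin
        count A?                               ≡⟨ count-by-fibres ⟩
        sum (λ j → count-fibre (to j))         ≤⟨ sum-mono (λ j → step (to j)) ⟩
        sum (λ j → indicator (B? (to j)) * m)  ≡⟨ *-distribʳ-sum m (λ j → indicator (B? (to j))) ⟨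
        count B? * m                           ∎
        where
        open ℕ.≤-Reasoning
        step : ∀ b → count-fibre b ≤ indicator (B? b) * m
        step b with B? b
        ... | yes p = ℕ.≤-trans (bound b p) (ℕ.≤-reflexive (sym (ℕ.*-identityˡ m)))
        ... | no ¬p = ℕ.≤-trans
          (sum-mono (λ i → indicator-mono (A? (to i) ×-dec (f (to i) ≟ b)) (no id) (λ (a , eq) → ¬p (subst B eq (f∈B (to i) a)))))
          (ℕ.≤-reflexive (sum-replicate-zero size))

      -- Fibres over points outside `B` can only add to `count A?`.
      count-fibre-≥ : (∀ b → B b → m ≤ count-fibre b) → count B? * m ≤ count A?
      count-fibre-≥ bound = begin
        count B? * m                           ≡⟨ *-distribʳ-sum m (λ j → indicator (B? (to j))) ⟩
        sum (λ j → indicator (B? (to j)) * m)  ≤⟨ sum-mono (λ j → step (to j)) ⟩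
        sum (λ j → count-fibre (to j))         ≡⟨ count-by-fibres ⟨
        count A?                               ∎
        where
        open ℕ.≤-Reasoning
        step : ∀ b → indicator (B? b) * m ≤ count-fibre b
        step b with B? b
        ... | yes p = ℕ.≤-trans (ℕ.≤-reflexive (ℕ.*-identityˡ m)) (bound b p)
        ... | no _  = z≤n

  count-injective : (A? : Decidable A) (B? : Decidable B) (f : Carrier → Carrier) →
    (∀ x → A x → B (f x)) → (∀ x y → A x → A y → f x ≡ f y → x ≡ y) → count A? ≤ count B?
  count-injective A? B? f f∈B inj = ℕ.≤-trans
    (count-fibre-≤ A? f B? 1 f∈B (λ b _ → count-subsingleton (λ x → A? x ×-dec (f x ≟ b)) (λ x y (Ax , fx≡b) (Ay , fy≡b)
          → inj x y Ax Ay (trans fx≡b (sym fy≡b)))))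
    (ℕ.≤-reflexive (ℕ.*-identityʳ _))

  count-none : (A? : Decidable A) → (∀ x → ¬ A x) → count A? ≡ 0
  count-none A? none = trans (sum-cong-≗ (λ i → cong (if_then 1 else 0) (dec-false (A? (to i)) (none (to i))))) (sum-replicate-zero size)

-- The ring solver with integer coefficients, so that it can cancel opposite terms.
module IntegerSolver (R : CommutativeRing 0ℓ 0ℓ) where
  open CommutativeRing R renaming (Carrier to K; _+_ to _⊕_; _*_ to _⊗_; -_ to ⊖_; refl to ≈-refl; sym to ≈-sym; trans to ≈-trans)
  open Algebra.Properties.Ring ring
  open Algebra.Properties.Semiring.Mult.TCOptimised semiring using (×1-homo-*) renaming (_×_ to _·_; ×-homo-+ to ·-homo-+; 1+× to 1+·)
  open import Relation.Binary.Reasoning.Setoid setoid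

  ⟦_⟧ : ℤ → K
  ⟦ + n ⟧      = n · 1#
  ⟦ -[1+ n ] ⟧ = ⊖ (suc n · 1#)

  ⟦⊖⟧ : ∀ m n → ⟦ m ℤ.⊖ n ⟧ ≈ m · 1# ⊕ ⊖ (n · 1#)
  ⟦⊖⟧ zero    zero    = ≈-sym (-‿inverseʳ 0#)
  ⟦⊖⟧ zero    (suc n) = ≈-sym (+-identityˡ _)
  ⟦⊖⟧ (suc m) zero    = ≈-sym (≈-trans (+-congˡ -0#≈0#) (+-identityʳ _))
  ⟦⊖⟧ (suc m) (suc n) = begin
    ⟦ suc m ℤ.⊖ suc n ⟧                           ≡⟨ cong ⟦_⟧ (ℤ.[1+m]⊖[1+n]≡m⊖n m n) ⟩
    ⟦ m ℤ.⊖ n ⟧                                   ≈⟨ ⟦⊖⟧ m n ⟩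
    m · 1# ⊕ ⊖ (n · 1#)                           ≈⟨ +-congˡ (+-identityˡ _) ⟨
    m · 1# ⊕ (0# ⊕ ⊖ (n · 1#))                    ≈⟨ +-congˡ (+-congʳ (-‿inverseʳ 1#)) ⟨
    m · 1# ⊕ (1# ⊕ ⊖ 1# ⊕ ⊖ (n · 1#))             ≈⟨ +-congˡ (+-assoc _ _ _) ⟩
    m · 1# ⊕ (1# ⊕ (⊖ 1# ⊕ ⊖ (n · 1#)))           ≈⟨ +-assoc _ _ _ ⟨
    m · 1# ⊕ 1# ⊕ (⊖ 1# ⊕ ⊖ (n · 1#))             ≈⟨ +-cong (+-comm _ _) (-‿+-comm _ _) ⟩
    1# ⊕ m · 1# ⊕ ⊖ (1# ⊕ n · 1#)                 ≈⟨ +-cong (1+· m 1#) (-‿cong (1+· n 1#)) ⟨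
    suc m · 1# ⊕ ⊖ (suc n · 1#)                   ∎

  ⟦⟧-neg : ∀ i → ⟦ ℤ.- i ⟧ ≈ ⊖ ⟦ i ⟧
  ⟦⟧-neg (+ zero)   = ≈-sym -0#≈0#
  ⟦⟧-neg (+ suc n)  = ≈-refl
  ⟦⟧-neg -[1+ n ]   = ≈-sym (-‿involutive _)

  ⟦⟧-+ : ∀ i j → ⟦ i ℤ.+ j ⟧ ≈ ⟦ i ⟧ ⊕ ⟦ j ⟧
  ⟦⟧-+ (+ m)    (+ n)    = ·-homo-+ 1# m n
  ⟦⟧-+ (+ m)    -[1+ n ] = ⟦⊖⟧ m (suc n)
  ⟦⟧-+ -[1+ m ] (+ n)    = ≈-trans (⟦⊖⟧ n (suc m)) (+-comm _ _)
  ⟦⟧-+ -[1+ m ] -[1+ n ] = begin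
    ⊖ (suc (suc (m + n)) · 1#)           ≡⟨ cong (λ k → ⊖ (suc k · 1#)) (ℕ.+-suc m n) ⟨
    ⊖ ((suc m + suc n) · 1#)             ≈⟨ -‿cong (·-homo-+ 1# (suc m) (suc n)) ⟩
    ⊖ (suc m · 1# ⊕ suc n · 1#)          ≈⟨ -‿+-comm _ _ ⟨
    ⊖ (suc m · 1#) ⊕ ⊖ (suc n · 1#)      ∎

  ⟦⟧-*⁺ : ∀ m j → ⟦ + m ℤ.* j ⟧ ≈ m · 1# ⊗ ⟦ j ⟧
  ⟦⟧-*⁺ m (+ n) = ≈-trans (reflexive (cong ⟦_⟧ (sym (ℤ.pos-* m n)))) (×1-homo-* m n)
  ⟦⟧-*⁺ m -[1+ n ] = begin
    ⟦ + m ℤ.* -[1+ n ] ⟧        ≡⟨ cong ⟦_⟧ (ℤ.neg-distribʳ-* (+ m) (+ suc n)) ⟨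
    ⟦ ℤ.- (+ m ℤ.* + suc n) ⟧   ≈⟨ ⟦⟧-neg (+ m ℤ.* + suc n) ⟩
    ⊖ ⟦ + m ℤ.* + suc n ⟧       ≈⟨ -‿cong (⟦⟧-*⁺ m (+ suc n)) ⟩
    ⊖ (m · 1# ⊗ suc n · 1#)     ≈⟨ -‿distribʳ-* _ _ ⟩
    m · 1# ⊗ ⊖ (suc n · 1#)     ∎

  ⟦⟧-* : ∀ i j → ⟦ i ℤ.* j ⟧ ≈ ⟦ i ⟧ ⊗ ⟦ j ⟧
  ⟦⟧-* (+ m)    j = ⟦⟧-*⁺ m j
  ⟦⟧-* -[1+ m ] j = begin
    ⟦ -[1+ m ] ℤ.* j ⟧          ≡⟨ cong ⟦_⟧ (ℤ.neg-distribˡ-* (+ suc m) j) ⟨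
    ⟦ ℤ.- (+ suc m ℤ.* j) ⟧     ≈⟨ ⟦⟧-neg (+ suc m ℤ.* j) ⟩
    ⊖ ⟦ + suc m ℤ.* j ⟧         ≈⟨ -‿cong (⟦⟧-*⁺ (suc m) j) ⟩
    ⊖ (suc m · 1# ⊗ ⟦ j ⟧)      ≈⟨ -‿distribˡ-* _ _ ⟩
    ⊖ (suc m · 1#) ⊗ ⟦ j ⟧      ∎

  coeff≟ : ∀ i j → Maybe (⟦ i ⟧ ≈ ⟦ j ⟧)
  coeff≟ i j with i ℤ.≟ j
  ... | yes refl = just ≈-refl
  ... | no _     = nothing

  ℤ⟶R : ℤ.+-*-rawRing -Raw-AlmostCommutative⟶ fromCommutativeRing R
  ℤ⟶R = record { ⟦_⟧ = ⟦_⟧ ; +-homo = ⟦⟧-+ ; *-homo = ⟦⟧-* ; -‿homo = ⟦⟧-neg ; 0-homo = ≈-refl ; 1-homo = ≈-refl }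

  open Algebra.Solver.Ring ℤ.+-*-rawRing (fromCommutativeRing R) ℤ⟶R coeff≟ public
    using (Polynomial; solve; con; _:+_; _:*_; _:-_; :-_; _:=_)

-- Binomial coefficients modulo a prime

C-absorption : ∀ n k → suc k * (suc n C suc k) ≡ suc n * (n C k)
C-absorption zero    zero    = refl
C-absorption zero    (suc k) = ℕ.*-zeroʳ (suc (suc k))
C-absorption (suc n) zero    = trans (ℕ.*-identityˡ _) (trans (nC1≡n (suc (suc n))) (sym (ℕ.*-identityʳ _)))
C-absorption (suc n) (suc k) = begin
  suc (suc k) * (suc (suc n) C suc (suc k))
    ≡⟨ cong (suc (suc k) *_) (nCk+nC[k+1]≡[n+1]C[k+1] (suc n) (suc k)) ⟨
  suc (suc k) * (c + (suc n C suc (suc k)))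
    ≡⟨ ℕ.*-distribˡ-+ (suc (suc k)) c _ ⟩
  (c + suc k * c) + suc (suc k) * (suc n C suc (suc k))
    ≡⟨ cong₂ (λ u v → (c + u) + v) (C-absorption n k) (C-absorption n (suc k)) ⟩
  (c + suc n * (n C k)) + suc n * (n C suc k)
    ≡⟨ ℕ.+-assoc c _ _ ⟩
  c + (suc n * (n C k) + suc n * (n C suc k))
    ≡⟨ cong (_+_ c) (ℕ.*-distribˡ-+ (suc n) (n C k) (n C suc k)) ⟨
  c + suc n * (n C k + n C suc k)
    ≡⟨ cong (λ u → c + suc n * u) (nCk+nC[k+1]≡[n+1]C[k+1] n k) ⟩
  suc (suc n) * c ∎
  where
  open ≡-Reasoning
  c = suc n C suc k

-- By absorption the prime divides `suc k` times the coefficient, and it cannot divide the smaller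
-- positive number `suc k`.
prime∣C : ∀ {p} k → Prime (suc p) → suc k < suc p → suc p ∣ suc p C suc k
prime∣C {p} k pp k<p with euclidsLemma (suc k) (suc p C suc k) pp
                         (subst (suc p ∣_) (sym (C-absorption p k)) (m∣m*n (p C k)))
... | inj₁ p∣k = contradiction (∣⇒≤ p∣k) (ℕ.<⇒≱ k<p)
... | inj₂ p∣C = p∣C

-- Sums and products over all elements of a finite field

module _ (M : CommutativeMonoid 0ℓ 0ℓ) where
  open CommutativeMonoid M renaming (refl to ≈-refl; trans to ≈-trans; sym to ≈-sym) hiding (_≉_)
  open Algebra.Properties.CommutativeMonoid.Sum M
    using (sum-cong-≋; sum-permute) renaming (sum to ∑; sum-replicate-zero to ∑-replicate-zero)

  -- Serves twice: all but one of the remaining terms of a binomial expansion vanish, and a product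
  -- of correction factors is trivial away from 0.
  sum-select : ∀ {n} (i : Fin n) (t : Fin n → Carrier) → (∀ j → j ≢ i → t j ≈ ε) → ∑ t ≈ t i
  sum-select {suc n} zero t rest = ≈-trans
    (∙-congˡ (≈-trans (sum-cong-≋ (λ j → rest (suc j) λ ())) (∑-replicate-zero n)))
    (identityʳ _)
  sum-select {suc n} (suc i) t rest = ≈-trans
    (∙-cong (rest zero λ ()) (sum-select i (t ∘ suc) (λ j j≢i → rest (suc j) (j≢i ∘ Fin.suc-injective))))
    (identityˡ _)

  module _ (F : FiniteField) where
    open FiniteField F using (enum) renaming (Carrier to K)
    open Inverse enum using (to; from)
    open Counting F using (to∘from; from∘to)

    sum-reindex : (f : K → Carrier) (g h : K → K) → (∀ x → g (h x) ≡ x) → (∀ x → h (g x) ≡ x) →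
      ∑ (f ∘ to) ≈ ∑ (f ∘ g ∘ to)
    sum-reindex f g h gh hg = ≈-trans (sum-permute (f ∘ to) π)
      (sum-cong-≋ (λ i → reflexive (cong f (to∘from (g (to i))))))
      where
      inv : ∀ u v → (∀ x → u (v x) ≡ x) → ∀ i → from (u (to (from (v (to i))))) ≡ i
      inv u v uv i = trans (cong (from ∘ u) (to∘from _)) (trans (cong from (uv (to i))) (from∘to i))
      π : Permutation _ _
      π = permutation (λ i → from (g (to i))) (λ i → from (h (to i))) (inv g h gh) (inv h g hg)

    sum-select-to : (f : K → Carrier) (x : K) → (∀ y → y ≢ x → f y ≈ ε) → ∑ (f ∘ to) ≈ f x
    sum-select-to f x rest = ≈-trans
      (sum-select (from x) (f ∘ to) (λ j j≢ → rest (to j) (λ to≡ → j≢ (trans (sym (from∘to j)) (cong from to≡)))))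
      (reflexive (cong f (to∘from x)))

-- Field arithmetic, Fermat's theorem and the Frobenius map

module Field (F : FiniteField) where
  open FiniteField F
  open Inverse enum using (to; from)

  private
    variable
      x y z : Carrier

  commutativeRing : CommutativeRing 0ℓ 0ℓ
  commutativeRing = record { isCommutativeRing = isCommutativeRing }

  open IsCommutativeRing isCommutativeRing public
    using (+-identityˡ; +-identityʳ; +-comm; -‿inverseʳ; *-comm; *-assoc; *-identityˡ; *-identityʳ; zeroˡ; zeroʳ; distribˡ)
  open IntegerSolver commutativeRing public
  open CommutativeRing commutativeRing using (+-commutativeMonoid; *-commutativeMonoid; commutativeSemiring; semiring)

  ⊕-cancel-≡0 : x ⊕ ⊖ y ≡ 0# → x ≡ y
  ⊕-cancel-≡0 {x} {y} eq = begin
    x             ≡⟨ solve 2 (λ x y → x := x :- y :+ y) refl x y ⟩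
    x ⊕ ⊖ y ⊕ y   ≡⟨ cong (_⊕ y) eq ⟩
    0# ⊕ y        ≡⟨ +-identityˡ y ⟩
    y             ∎
    where open ≡-Reasoning

  inverse-cancel : x ≢ 0# → ∀ y → x ⊗ (y ⊗ x ⁻¹) ≡ y
  inverse-cancel {x} x≢0 y = begin
    x ⊗ (y ⊗ x ⁻¹)   ≡⟨ solve 3 (λ x y i → x :* (y :* i) := x :* i :* y) refl x y (x ⁻¹) ⟩
    x ⊗ x ⁻¹ ⊗ y     ≡⟨ cong (_⊗ y) (⁻¹-inverse x x≢0) ⟩
    1# ⊗ y           ≡⟨ *-identityˡ y ⟩
    y                ∎
    where open ≡-Reasoning

  inverse-cancel′ : x ≢ 0# → ∀ y → x ⊗ y ⊗ x ⁻¹ ≡ y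
  inverse-cancel′ {x} x≢0 y = trans (*-assoc x y (x ⁻¹)) (inverse-cancel x≢0 y)

  ⊗-cancelˡ : x ≢ 0# → x ⊗ y ≡ x ⊗ z → y ≡ z
  ⊗-cancelˡ {x} {y} {z} x≢0 eq = trans (sym (inverse-cancel′ x≢0 y)) (trans (cong (_⊗ x ⁻¹) eq) (inverse-cancel′ x≢0 z))

  ⊗-≡0 : x ≢ 0# → x ⊗ y ≡ 0# → y ≡ 0#
  ⊗-≡0 {x} x≢0 eq = ⊗-cancelˡ x≢0 (trans eq (sym (zeroʳ x)))

  ⊗-≢0 : x ≢ 0# → y ≢ 0# → x ⊗ y ≢ 0#
  ⊗-≢0 x≢0 y≢0 eq = y≢0 (⊗-≡0 x≢0 eq)

  ⊗-≢0ˡ : x ⊗ y ≢ 0# → x ≢ 0#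
  ⊗-≢0ˡ {x} {y} xy≢0 refl = xy≢0 (zeroˡ y)

  ⊗-≢0ʳ : x ⊗ y ≢ 0# → y ≢ 0#
  ⊗-≢0ʳ {x} {y} xy≢0 refl = xy≢0 (zeroʳ x)

  /-⊗ : y ≢ 0# → x / y ⊗ y ≡ x
  /-⊗ {y} {x} y≢0 = trans (*-comm _ y) (inverse-cancel y≢0 x)

  /-≢0 : x ≢ 0# → y ≢ 0# → x / y ≢ 0#
  /-≢0 {x} {y} x≢0 y≢0 eq = x≢0 (trans (sym (/-⊗ y≢0)) (trans (cong (_⊗ y) eq) (zeroˡ y)))

  **-homo-+ : ∀ x m n → x ** (m + n) ≡ x ** m ⊗ x ** n
  **-homo-+ x zero    n = sym (*-identityˡ _)
  **-homo-+ x (suc m) n = trans (cong (x ⊗_) (**-homo-+ x m n)) (sym (*-assoc x _ _))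

  1**n≡1 : ∀ n → 1# ** n ≡ 1#
  1**n≡1 zero    = refl
  1**n≡1 (suc n) = trans (*-identityˡ _) (1**n≡1 n)

  **-distrib-⊗ : ∀ x y n → (x ⊗ y) ** n ≡ x ** n ⊗ y ** n
  **-distrib-⊗ x y zero    = sym (*-identityˡ 1#)
  **-distrib-⊗ x y (suc n) = trans (cong ((x ⊗ y) ⊗_) (**-distrib-⊗ x y n))
    (solve 4 (λ x y u v → x :* y :* (u :* v) := x :* u :* (y :* v)) refl x y (x ** n) (y ** n))

  **-assoc : ∀ x m n → (x ** m) ** n ≡ x ** (m * n)
  **-assoc x zero    n = 1**n≡1 n
  **-assoc x (suc m) n = begin
    (x ⊗ x ** m) ** n        ≡⟨ **-distrib-⊗ x (x ** m) n ⟩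
    x ** n ⊗ (x ** m) ** n   ≡⟨ cong (x ** n ⊗_) (**-assoc x m n) ⟩
    x ** n ⊗ x ** (m * n)    ≡⟨ **-homo-+ x n (m * n) ⟨
    x ** (n + m * n)         ∎
    where open ≡-Reasoning

  **-≡0 : ∀ n → x ** n ≡ 0# → x ≡ 0#
  **-≡0 zero 1≡0 = contradiction (sym 1≡0) 0≢1
  **-≡0 {x} (suc n) eq with x ≟ 0#
  ... | yes x≡0 = x≡0
  ... | no x≢0  = **-≡0 n (⊗-≡0 x≢0 eq)

  module ∑ = Algebra.Properties.CommutativeMonoid.Sum +-commutativeMonoid
  module ∏ = Algebra.Properties.CommutativeMonoid.Sum *-commutativeMonoid
  open Algebra.Properties.Semiring.Mult semiring using (×1-homo-*; ×-homo-1; ×-assoc-*; ×-assocˡ) renaming (_×_ to _·_)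

  -- Translation by 1 permutes the field, so the sum `S` of all elements equals `S` plus `size`
  -- copies of 1.
  size·1≡0 : size · 1# ≡ 0#
  size·1≡0 = begin
    size · 1#                ≡⟨ solve 2 (λ s t → t := s :+ t :- s) refl S (size · 1#) ⟩
    S ⊕ size · 1# ⊕ ⊖ S      ≡⟨ cong (_⊕ ⊖ S) translated ⟨
    S ⊕ ⊖ S                  ≡⟨ -‿inverseʳ S ⟩
    0#                       ∎
    where
    open ≡-Reasoning
    S = ∑.sum to
    translated : S ≡ S ⊕ size · 1#
    translated = begin
      S                               ≡⟨ sum-reindex +-commutativeMonoid F id (_⊕ 1#) (_⊕ ⊖ 1#)
                                           (solve 1 (λ x → x :- con (+ 1) :+ con (+ 1) := x) refl)
                                           (solve 1 (λ x → x :+ con (+ 1) :- con (+ 1) := x) refl) ⟩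
      ∑.sum (λ i → to i ⊕ 1#)         ≡⟨ ∑.∑-distrib-+ to (λ _ → 1#) ⟩
      S ⊕ ∑.sum {size} (λ _ → 1#)     ≡⟨ cong (S ⊕_) (∑.sum-replicate size) ⟩
      S ⊕ size · 1#                   ∎

  [^]·1 : ∀ n m → (n ^ m) · 1# ≡ (n · 1#) ** m
  [^]·1 n zero    = +-identityʳ 1#
  [^]·1 n (suc m) = trans (×1-homo-* n (n ^ m)) (cong (n · 1# ⊗_) ([^]·1 n m))

  prod-const : ∀ n x → ∏.sum {n} (λ _ → x) ≡ x ** n
  prod-const zero    x = refl
  prod-const (suc n) x = cong (x ⊗_) (prod-const n x)

  prod-≢0 : ∀ {n} (t : Fin n → Carrier) → (∀ i → t i ≢ 0#) → ∏.sum t ≢ 0#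
  prod-≢0 {zero}  t t≢0 = 0≢1 ∘ sym
  prod-≢0 {suc n} t t≢0 = ⊗-≢0 (t≢0 zero) (prod-≢0 (t ∘ suc) (t≢0 ∘ suc))

  -- Compare the products of all nonzero x and of all nonzero u x; the correction u at x = 0
  -- turns u ^ (size - 1) = 1 into a statement that also holds for u = 0.
  fermat : ∀ u → u ** size ≡ u
  fermat u with u ≟ 0#
  ... | yes refl = 0**size size refl
    where
    0**size : ∀ n → size ≡ n → 0# ** n ≡ 0#
    0**size (suc n) _  = zeroˡ _
    0**size zero    eq with () ← subst Fin eq (from 0#)
  ... | no u≢0 = ⊗-cancelˡ (prod-≢0 (g ∘ to) (λ i → g≢0 (to i))) (begin
    ∏.sum (g ∘ to) ⊗ u ** size                                      ≡⟨ *-comm _ _ ⟩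
    u ** size ⊗ ∏.sum (g ∘ to)                                      ≡⟨ cong (_⊗ ∏.sum (g ∘ to)) (prod-const size u) ⟨
    ∏.sum {size} (λ _ → u) ⊗ ∏.sum (g ∘ to)                         ≡⟨ ∏.∑-distrib-+ (λ _ → u) (g ∘ to) ⟨
    ∏.sum (λ i → u ⊗ g (to i))                                      ≡⟨ ∏.sum-cong-≗ (λ i → step (to i)) ⟩
    ∏.sum (λ i → g (u ⊗ to i) ⊗ e (to i))                           ≡⟨ ∏.∑-distrib-+ (λ i → g (u ⊗ to i)) (e ∘ to) ⟩
    ∏.sum (λ i → g (u ⊗ to i)) ⊗ ∏.sum (e ∘ to)
      ≡⟨ cong₂ _⊗_ (sym (sum-reindex *-commutativeMonoid F g (u ⊗_) (λ x → x ⊗ u ⁻¹) (inverse-cancel u≢0) (inverse-cancel′ u≢0)))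
                   (sum-select-to *-commutativeMonoid F e 0# e-nonzero) ⟩
    ∏.sum (g ∘ to) ⊗ e 0#                                           ≡⟨ cong (∏.sum (g ∘ to) ⊗_) e0≡u ⟩
    ∏.sum (g ∘ to) ⊗ u                                              ∎)
    where
    open ≡-Reasoning
    g e : Carrier → Carrier
    g x with x ≟ 0#
    ... | yes _ = 1#
    ... | no _  = x
    e x with x ≟ 0#
    ... | yes _ = u
    ... | no _  = 1#
    g≢0 : ∀ x → g x ≢ 0#
    g≢0 x with x ≟ 0#
    ... | yes _  = 0≢1 ∘ sym
    ... | no x≢0 = x≢0
    e-nonzero : ∀ y → y ≢ 0# → e y ≡ 1#
    e-nonzero y y≢0 with y ≟ 0#
    ... | yes y≡0 = contradiction y≡0 y≢0
    ... | no _    = refl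
    e0≡u : e 0# ≡ u
    e0≡u with 0# ≟ 0#
    ... | yes _  = refl
    ... | no 0≢0 = contradiction refl 0≢0
    step : ∀ x → u ⊗ g x ≡ g (u ⊗ x) ⊗ e x
    step x with x ≟ 0# | (u ⊗ x) ≟ 0#
    ... | yes _   | yes _     = solve 1 (λ u → u :* con (+ 1) := con (+ 1) :* u) refl u
    ... | yes x≡0 | no ux≢0   = contradiction (trans (cong (u ⊗_) x≡0) (zeroʳ u)) ux≢0
    ... | no x≢0  | yes ux≡0  = contradiction (⊗-≡0 u≢0 ux≡0) x≢0
    ... | no _    | no _      = sym (*-identityʳ _)

  Additive : ℕ → Set
  Additive n = ∀ x y → (x ⊕ y) ** n ≡ x ** n ⊕ y ** n

  additive-^ : ∀ {n} → Additive n → ∀ m → Additive (n ^ m)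
  additive-^ {n} add zero x y = trans (*-identityʳ _) (sym (cong₂ _⊕_ (*-identityʳ x) (*-identityʳ y)))
  additive-^ {n} add (suc m) x y = begin
    (x ⊕ y) ** (n * n ^ m)                       ≡⟨ **-assoc _ n (n ^ m) ⟨
    ((x ⊕ y) ** n) ** (n ^ m)                    ≡⟨ cong (_** (n ^ m)) (add x y) ⟩
    (x ** n ⊕ y ** n) ** (n ^ m)                 ≡⟨ additive-^ add m _ _ ⟩
    (x ** n) ** (n ^ m) ⊕ (y ** n) ** (n ^ m)    ≡⟨ cong₂ _⊕_ (**-assoc x n (n ^ m)) (**-assoc y n (n ^ m)) ⟩
    x ** (n * n ^ m) ⊕ y ** (n * n ^ m)          ∎
    where open ≡-Reasoning

  module _ {p : ℕ} (p-prime : Prime p) (p·1≡0 : p · 1# ≡ 0#) where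
    open Algebra.Properties.Semiring.Exp semiring using () renaming (_^_ to _^ᴷ_)
    open Algebra.Properties.CommutativeSemiring.Binomial commutativeSemiring using (theorem; binomialTerm)

    private
      **≡^ᴷ : ∀ x n → x ** n ≡ x ^ᴷ n
      **≡^ᴷ x zero    = refl
      **≡^ᴷ x (suc n) = cong (x ⊗_) (**≡^ᴷ x n)

    p∣n⇒n·x≡0 : ∀ {n} x → p ∣ n → n · x ≡ 0#
    p∣n⇒n·x≡0 x (divides m refl) = begin
      (m * p) · x         ≡⟨ cong (_· x) (ℕ.*-comm m p) ⟩
      (p * m) · x         ≡⟨ ×-assocˡ x p m ⟨
      p · (m · x)         ≡⟨ cong (p ·_) (*-identityˡ (m · x)) ⟨
      p · (1# ⊗ (m · x))  ≡⟨ ×-assoc-* p 1# (m · x) ⟨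
      p · 1# ⊗ (m · x)    ≡⟨ cong (_⊗ (m · x)) p·1≡0 ⟩
      0# ⊗ (m · x)        ≡⟨ zeroˡ _ ⟩
      0#                  ∎
      where open ≡-Reasoning

    -- In the binomial expansion every inner coefficient is divisible by `p` and hence vanishes;
    -- only the two outer powers survive.
    frobenius-additive : Additive p
    frobenius-additive x y = go p p-prime refl
      where
      open ≡-Reasoning
      -- Generalising `p` to `n` allows a match on `suc n`, which exposes the first term of the
      -- expansion.
      go : ∀ n → Prime n → n ≡ p → (x ⊕ y) ** n ≡ x ** n ⊕ y ** n
      go (suc n) pp n≡p = begin
        (x ⊕ y) ** suc n                            ≡⟨ **≡^ᴷ _ (suc n) ⟩
        (x ⊕ y) ^ᴷ suc n                            ≡⟨ theorem (suc n) x y ⟩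
        term zero ⊕ ∑.sum (λ k → term (suc k))
          ≡⟨ cong (term zero ⊕_) (sum-select +-commutativeMonoid (fromℕ n) (λ k → term (suc k)) middle) ⟩
        term zero ⊕ term (suc (fromℕ n))            ≡⟨ +-comm _ _ ⟩
        term (suc (fromℕ n)) ⊕ term zero            ≡⟨ cong₂ _⊕_ top bottom ⟩
        x ** suc n ⊕ y ** suc n                     ∎
        where
        term : Fin (suc (suc n)) → Carrier
        term = binomialTerm x y (suc n)
        bottom : term zero ≡ y ** suc n
        bottom = trans (×-homo-1 _) (trans (*-identityˡ _) (sym (**≡^ᴷ y (suc n))))
        top : term (suc (fromℕ n)) ≡ x ** suc n
        top rewrite Fin.toℕ-fromℕ n | nCn≡1 (suc n) | ℕ.n∸n≡0 n =
          trans (×-homo-1 _) (trans (*-identityʳ _) (sym (**≡^ᴷ x (suc n))))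
        middle : ∀ k → k ≢ fromℕ n → term (suc k) ≡ 0#
        middle k k≢n = p∣n⇒n·x≡0 _ (subst (_∣ (suc n C suc (toℕ k))) n≡p (prime∣C (toℕ k) pp (s≤s k<n)))
          where
          k<n : toℕ k < n
          k<n = ℕ.≤∧≢⇒< (ℕ.s≤s⁻¹ (Fin.toℕ<n k)) (λ eq → k≢n (Fin.toℕ-injective (trans eq (sym (Fin.toℕ-fromℕ n)))))

-- Division of skew polynomials by X - y

module SyntheticDivision (F : FiniteField) (σ : FiniteField.Carrier F → FiniteField.Carrier F) where
  open FiniteField F
  open Field F

  -- proj (a₀ ∷ a₁ ∷ a₂ ∷ …) y = a₀ + a₁ y + a₂ y σ(y) + a₃ y σ(y) σ²(y) + ⋯
  proj : ∀ {n} → Vec Carrier n → Carrier → Carrier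
  proj []       y = 0#
  proj (a ∷ as) y = a ⊕ y ⊗ proj as (σ y)

  -- In K[X;σ], where X a = σ(a) X, one has as = quot y as · (X − y) + proj as y.
  quot : ∀ {n} → Carrier → Vec Carrier (suc n) → Vec Carrier n
  quot y (a ∷ [])     = []
  quot y (a ∷ b ∷ bs) = proj (b ∷ bs) (σ y) ∷ quot (σ y) (b ∷ bs)

  -- Keeps inductions on the degree going: a nonzero polynomial with root `y` has a nonzero
  -- quotient. The head of the quotient is the value of the tail at `σ y`; if it vanishes, the root
  -- condition leaves only `a`, and the tail has a root at `σ y` in turn.
  quot-zero : ∀ {n} y (as : Vec Carrier (suc n)) → proj as y ≡ 0# → All (_≡ 0#) (quot y as) → All (_≡ 0#) as
  quot-zero y (a ∷ []) root [] = trans (solve 2 (λ a y → a := a :+ y :* con (+ 0)) refl a y) root ∷ []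
  quot-zero y (a ∷ b ∷ bs) root (r≡0 ∷ zeros) = a≡0 ∷ quot-zero (σ y) (b ∷ bs) r≡0 zeros
    where
    open ≡-Reasoning
    a≡0 : a ≡ 0#
    a≡0 = begin
      a                                    ≡⟨ solve 2 (λ a y → a := a :+ y :* con (+ 0)) refl a y ⟩
      a ⊕ y ⊗ 0#                           ≡⟨ cong (λ r → a ⊕ y ⊗ r) r≡0 ⟨
      a ⊕ y ⊗ proj (b ∷ bs) (σ y)          ≡⟨ root ⟩
      0#                                   ∎

-- Ordinary polynomials, as the case σ = id

module PlainPolynomials (F : FiniteField) where
  open FiniteField F
  open Field F
  open Counting F
  open SyntheticDivision F id

  proj-quot : ∀ {n} (as : Vec Carrier (suc n)) x y →
    proj as x ≡ proj (quot y as) x ⊗ (x ⊕ ⊖ y) ⊕ proj as y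
  proj-quot (a ∷ []) x y =
    solve 3 (λ a x y → a :+ x :* con (+ 0) := con (+ 0) :* (x :- y) :+ (a :+ y :* con (+ 0))) refl a x y
  proj-quot (a ∷ b ∷ bs) x y = trans (cong (λ u → a ⊕ x ⊗ u) (proj-quot (b ∷ bs) x y))
    (solve 5 (λ a x y u v → a :+ x :* (u :* (x :- y) :+ v) := (v :+ x :* u) :* (x :- y) :+ (a :+ y :* v)) refl
      a x y (proj (quot y (b ∷ bs)) x) (proj (b ∷ bs) y))

  -- Any root other than `y` is a root of the quotient by X - y, since the factor `x ⊕ ⊖ y` is then
  -- invertible.
  count-roots-≤ : ∀ {n} (as : Vec Carrier (suc n)) → ¬ All (_≡ 0#) as → count (λ x → proj as x ≟ 0#) ≤ n
  count-roots-≤ {n} as as≢0 with search (λ x → proj as x ≟ 0#)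
  ... | no none = ℕ.≤-trans (ℕ.≤-reflexive (count-none (λ x → proj as x ≟ 0#) (λ x r → none (x , r)))) z≤n
  count-roots-≤ {zero} as@(a ∷ []) as≢0 | yes (y , root) = contradiction (quot-zero y as root []) as≢0
  count-roots-≤ {suc n} as as≢0 | yes (y , root) = begin
    count (λ x → proj as x ≟ 0#)                                ≡⟨ count-split (λ x → proj as x ≟ 0#) y root ⟩
    suc (count (λ x → ¬? (y ≟ x) ×-dec (proj as x ≟ 0#)))
      ≤⟨ s≤s (count-mono (λ x → ¬? (y ≟ x) ×-dec (proj as x ≟ 0#)) (λ x → proj (quot y as) x ≟ 0#) other) ⟩
    suc (count (λ x → proj (quot y as) x ≟ 0#))
      ≤⟨ s≤s (count-roots-≤ (quot y as) (as≢0 ∘ quot-zero y as root)) ⟩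
    suc n                                                       ∎
    where
    open ℕ.≤-Reasoning
    other : ∀ x → (y ≢ x) × (proj as x ≡ 0#) → proj (quot y as) x ≡ 0#
    other x (y≢x , px≡0) = ⊗-≡0 (λ x-y≡0 → y≢x (sym (⊕-cancel-≡0 x-y≡0))) (trans (*-comm _ _) q[x-y]≡0)
      where
      q = proj (quot y as) x
      q[x-y]≡0 : q ⊗ (x ⊕ ⊖ y) ≡ 0#
      q[x-y]≡0 = trans (sym (+-identityʳ _)) (trans (cong (q ⊗ (x ⊕ ⊖ y) ⊕_) (sym root)) (trans (sym (proj-quot as x y)) px≡0))

  monomial : ∀ n → Vec Carrier (suc n)
  monomial zero    = 1# ∷ []
  monomial (suc n) = 0# ∷ monomial n

  proj-monomial : ∀ n x → proj (monomial n) x ≡ x ** n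
  proj-monomial zero    x = solve 1 (λ x → con (+ 1) :+ x :* con (+ 0) := con (+ 1)) refl x
  proj-monomial (suc n) x = trans (+-identityˡ _) (cong (x ⊗_) (proj-monomial n x))

  -- Fixed points are roots of X^n - X. For n at least 2 the coefficient -1 stays apart from the
  -- leading one, so the polynomial is nonzero. With n = q this bounds the size of the fixed field
  -- of σ.
  count-fixed-≤ : ∀ n → 2 ≤ n → count (λ x → (x ** n) ≟ x) ≤ n
  count-fixed-≤ (suc (suc n)) (s≤s (s≤s z≤n)) = ℕ.≤-trans
    (count-mono (λ x → (x ** suc (suc n)) ≟ x) (λ x → proj (0# ∷ ⊖ 1# ∷ monomial n) x ≟ 0#)
      (λ x fixed → trans (value x) (trans (cong (_⊕ ⊖ x) fixed) (-‿inverseʳ x))))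
    (count-roots-≤ (0# ∷ ⊖ 1# ∷ monomial n) nonzero)
    where
    value : ∀ x → proj (0# ∷ ⊖ 1# ∷ monomial n) x ≡ x ** suc (suc n) ⊕ ⊖ x
    value x rewrite proj-monomial n x =
      solve 2 (λ x u → con (+ 0) :+ x :* (:- con (+ 1) :+ x :* u) := x :* (x :* u) :- x) refl x (x ** n)
    nonzero : ¬ All (_≡ 0#) (0# ∷ ⊖ 1# ∷ monomial n)
    nonzero (_ ∷ -1≡0 ∷ _) = 0≢1 (begin
      0#              ≡⟨ -‿inverseʳ 1# ⟨
      1# ⊕ ⊖ 1#       ≡⟨ cong (1# ⊕_) -1≡0 ⟩
      1# ⊕ 0#         ≡⟨ +-identityʳ 1# ⟩
      1#              ∎)
      where open ≡-Reasoning

-- Fibres of additive maps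

module AdditiveMaps (F : FiniteField) where
  open FiniteField F
  open Field F
  open Counting F

  kernel : (f : Carrier → Carrier) → Decidable (λ x → f x ≡ 0#)
  kernel f x = f x ≟ 0#

  -- Subtracting one point of a fibre embeds the fibre into the kernel.
  count-fibre-≤-kernel : (f : Carrier → Carrier) → (∀ x y → f (x ⊕ ⊖ y) ≡ f x ⊕ ⊖ f y) →
    ∀ b → count (λ x → f x ≟ b) ≤ count (kernel f)
  count-fibre-≤-kernel f f-sub b with search (λ x → f x ≟ b)
  ... | no none       = ℕ.≤-trans (ℕ.≤-reflexive (count-none (λ x → f x ≟ b) (λ x p → none (x , p)))) z≤n
  ... | yes (x₀ , p₀) = count-injective (λ x → f x ≟ b) (kernel f) (_⊕ ⊖ x₀)
    (λ x p → trans (f-sub x x₀) (trans (cong₂ (λ u v → u ⊕ ⊖ v) p p₀) (-‿inverseʳ b)))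
    (λ x y _ _ eq → trans (solve 2 (λ x c → x := x :- c :+ c) refl x x₀)
                   (trans (cong (_⊕ x₀) eq) (solve 2 (λ x c → x :- c :+ c := x) refl y x₀)))

  -- The counting substitute for rank-nullity. With `A` a kernel it gives upper bounds by induction
  -- on the degree; with `A` the whole field it gives lower bounds.
  count-≤-image*kernel : {A B : Pred Carrier 0ℓ} (A? : Decidable A) (B? : Decidable B) (f : Carrier → Carrier) →
    (∀ x y → f (x ⊕ ⊖ y) ≡ f x ⊕ ⊖ f y) → (∀ x → A x → B (f x)) → count A? ≤ count B? * count (kernel f)
  count-≤-image*kernel A? B? f f-sub f∈B = count-fibre-≤ A? f B? (count (kernel f)) f∈B
    (λ b _ → ℕ.≤-trans (count-mono (λ x → A? x ×-dec (f x ≟ b)) (λ x → f x ≟ b) (λ x → proj₂)) (count-fibre-≤-kernel f f-sub b))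

-- With q = 1 + r this is q³ - 1 = (q² + q + 1)(q - 1) without subtraction; `square-1+r` is q² - 1 =
-- (q + 1)(q - 1) in the same form.
cube-1+r : ∀ r → suc r ^ 3 ≡ suc ((suc r ^ 2 + suc r + 1) * r)
cube-1+r = solve 1 (λ r → (con 1 :+ r) :^ 3 := con 1 :+ ((con 1 :+ r) :^ 2 :+ (con 1 :+ r) :+ con 1) :* r) refl
  where open +-*-Solver

square-1+r : ∀ r → suc r ^ 2 ≡ suc (suc (suc r) * r)
square-1+r = solve 1 (λ r → (con 1 :+ r) :^ 2 := con 1 :+ (con 2 :+ r) :* r) refl
  where open +-*-Solver

-- The gap that decides the count for P: (q - 1)(q + 1) bounds the number of roots when the
-- remainder is not constant, against q² + q + 1 when it is.
r[2+r]<[1+r]²+[1+r]+1 : ∀ r → r * suc (suc r) < suc r ^ 2 + suc r + 1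
r[2+r]<[1+r]²+[1+r]+1 r = ℕ.≤-trans (ℕ.m≤m+n (suc (r * suc (suc r))) (r + 2)) (ℕ.≤-reflexive
  (solve 1 (λ r → con 1 :+ r :* (con 2 :+ r) :+ (r :+ con 2) := (con 1 :+ r) :^ 2 :+ (con 1 :+ r) :+ con 1) refl r))
  where open +-*-Solver

-- Skew polynomials acting on K through the operators θσ

module SkewPolynomials (F : FiniteField) where
  open FiniteField F
  open Field F
  open Counting F
  open AdditiveMaps F

  -- r is q - 1: it counts the nonzero elements of F_q without subtraction.
  module Semilinear (σ : Carrier → Carrier)
    (σ-⊕ : ∀ x y → σ (x ⊕ y) ≡ σ x ⊕ σ y)
    (σ-⊗ : ∀ x y → σ (x ⊗ y) ≡ σ x ⊗ σ y)
    (σ-1 : σ 1# ≡ 1#)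
    (σ⁵ : ∀ x → σ (σ (σ (σ (σ x)))) ≡ x)
    (r : ℕ) (0<r : 0 < r)
    (size≡q^5 : size ≡ suc r ^ 5)
    (count-fixed : count (λ x → σ x ≟ x) ≤ suc r)
    where

    q : ℕ
    q = suc r

    open SyntheticDivision F σ public

    σ-0 : σ 0# ≡ 0#
    σ-0 = begin
      σ 0#                       ≡⟨ solve 1 (λ s → s := s :+ s :- s) refl (σ 0#) ⟩
      σ 0# ⊕ σ 0# ⊕ ⊖ σ 0#       ≡⟨ cong (_⊕ ⊖ σ 0#) (σ-⊕ 0# 0#) ⟨
      σ (0# ⊕ 0#) ⊕ ⊖ σ 0#       ≡⟨ cong (λ u → σ u ⊕ ⊖ σ 0#) (+-identityˡ 0#) ⟩
      σ 0# ⊕ ⊖ σ 0#              ≡⟨ -‿inverseʳ (σ 0#) ⟩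
      0#                         ∎
      where open ≡-Reasoning

    σ-⊖ : ∀ x → σ (⊖ x) ≡ ⊖ σ x
    σ-⊖ x = begin
      σ (⊖ x)                  ≡⟨ solve 2 (λ s t → t := s :+ t :- s) refl (σ x) (σ (⊖ x)) ⟩
      σ x ⊕ σ (⊖ x) ⊕ ⊖ σ x    ≡⟨ cong (_⊕ ⊖ σ x) (σ-⊕ x (⊖ x)) ⟨
      σ (x ⊕ ⊖ x) ⊕ ⊖ σ x      ≡⟨ cong (λ u → σ u ⊕ ⊖ σ x) (-‿inverseʳ x) ⟩
      σ 0# ⊕ ⊖ σ x             ≡⟨ cong (_⊕ ⊖ σ x) σ-0 ⟩
      0# ⊕ ⊖ σ x               ≡⟨ +-identityˡ _ ⟩
      ⊖ σ x                    ∎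
      where open ≡-Reasoning

    σ-injective : ∀ {x y} → σ x ≡ σ y → x ≡ y
    σ-injective {x} {y} eq = trans (sym (σ⁵ x)) (trans (cong (λ u → σ (σ (σ (σ u)))) eq) (σ⁵ y))

    σ-≢0 : ∀ {x} → x ≢ 0# → σ x ≢ 0#
    σ-≢0 x≢0 eq = x≢0 (σ-injective (trans eq (sym σ-0)))

    norm : Carrier → Carrier
    norm x = x ⊗ σ x ⊗ σ (σ x) ⊗ σ (σ (σ x)) ⊗ σ (σ (σ (σ x)))

    σ-norm : ∀ x → σ (norm x) ≡ norm x
    σ-norm x = begin
      σ (x ⊗ x₁ ⊗ x₂ ⊗ x₃ ⊗ x₄)         ≡⟨ σ-⊗ _ _ ⟩
      σ (x ⊗ x₁ ⊗ x₂ ⊗ x₃) ⊗ σ x₄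
        ≡⟨ cong₂ _⊗_ (trans (σ-⊗ _ _) (cong (_⊗ x₄) (trans (σ-⊗ _ _) (cong (_⊗ x₃) (σ-⊗ x x₁))))) (σ⁵ x) ⟩
      x₁ ⊗ x₂ ⊗ x₃ ⊗ x₄ ⊗ x
        ≡⟨ solve 5 (λ a b c d e → b :* c :* d :* e :* a := a :* b :* c :* d :* e) refl x x₁ x₂ x₃ x₄ ⟩
      x ⊗ x₁ ⊗ x₂ ⊗ x₃ ⊗ x₄             ∎
      where
      open ≡-Reasoning
      x₁ = σ x
      x₂ = σ x₁
      x₃ = σ x₂
      x₄ = σ x₃

    norm-≢0 : ∀ {x} → x ≢ 0# → norm x ≢ 0#
    norm-≢0 x≢0 = ⊗-≢0 (⊗-≢0 (⊗-≢0 (⊗-≢0 x≢0 (σ-≢0 x≢0)) (σ-≢0 (σ-≢0 x≢0))) (σ-≢0 (σ-≢0 (σ-≢0 x≢0)))) (σ-≢0 (σ-≢0 (σ-≢0 (σ-≢0 x≢0))))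

    -- θσ ranges over the operators by which X can act on K.
    eval : ∀ {n} → Carrier → Vec Carrier n → Carrier → Carrier
    eval θ []       x = 0#
    eval θ (a ∷ as) x = a ⊗ x ⊕ eval θ as (θ ⊗ σ x)

    twist-⊕ : ∀ θ x y → θ ⊗ σ (x ⊕ y) ≡ θ ⊗ σ x ⊕ θ ⊗ σ y
    twist-⊕ θ x y = trans (cong (θ ⊗_) (σ-⊕ x y)) (distribˡ θ _ _)

    twist-⊖ : ∀ θ x → θ ⊗ σ (⊖ x) ≡ ⊖ (θ ⊗ σ x)
    twist-⊖ θ x = trans (cong (θ ⊗_) (σ-⊖ x)) (solve 2 (λ θ s → θ :* :- s := :- (θ :* s)) refl θ (σ x))

    eval-⊕ : ∀ {n} θ (as : Vec Carrier n) x y → eval θ as (x ⊕ y) ≡ eval θ as x ⊕ eval θ as y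
    eval-⊕ θ []       x y = sym (+-identityˡ 0#)
    eval-⊕ θ (a ∷ as) x y = trans
      (cong (a ⊗ (x ⊕ y) ⊕_) (trans (cong (eval θ as) (twist-⊕ θ x y)) (eval-⊕ θ as _ _)))
      (solve 5 (λ a x y u v → a :* (x :+ y) :+ (u :+ v) := a :* x :+ u :+ (a :* y :+ v)) refl a x y _ _)

    eval-⊖ : ∀ {n} θ (as : Vec Carrier n) x → eval θ as (⊖ x) ≡ ⊖ eval θ as x
    eval-⊖ θ []       x = solve 0 (con (+ 0) := :- con (+ 0)) refl
    eval-⊖ θ (a ∷ as) x = trans
      (cong (a ⊗ ⊖ x ⊕_) (trans (cong (eval θ as) (twist-⊖ θ x)) (eval-⊖ θ as _)))
      (solve 3 (λ a x u → a :* :- x :+ :- u := :- (a :* x :+ u)) refl a x _)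

    eval-sub : ∀ {n} θ (as : Vec Carrier n) x y → eval θ as (x ⊕ ⊖ y) ≡ eval θ as x ⊕ ⊖ eval θ as y
    eval-sub θ as x y = trans (eval-⊕ θ as x (⊖ y)) (cong (eval θ as x ⊕_) (eval-⊖ θ as y))

    eval-0 : ∀ {n} θ (as : Vec Carrier n) → eval θ as 0# ≡ 0#
    eval-0 θ as = trans (cong (eval θ as) (sym (-‿inverseʳ 0#))) (trans (eval-sub θ as 0# 0#) (-‿inverseʳ _))

    -- The action of X - y on `x` when X acts as θσ.
    line : Carrier → Carrier → Carrier → Carrier
    line θ y x = θ ⊗ σ x ⊕ ⊖ (y ⊗ x)

    line-sub : ∀ θ y u v → line θ y (u ⊕ ⊖ v) ≡ line θ y u ⊕ ⊖ line θ y v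
    line-sub θ y u v = trans (cong (λ t → θ ⊗ t ⊕ ⊖ (y ⊗ (u ⊕ ⊖ v))) (trans (σ-⊕ u (⊖ v)) (cong (σ u ⊕_) (σ-⊖ v))))
      (solve 6 (λ θ y u v s t → θ :* (s :- t) :- y :* (u :- v) := θ :* s :- y :* u :- (θ :* t :- y :* v)) refl θ y u v (σ u) (σ v))

    -- The division by X - y, read as an identity of operators. It holds for every θ because θσ
    -- moves past coefficients exactly as X does.
    eval-quot : ∀ {n} θ (as : Vec Carrier (suc n)) y x →
      eval θ as x ≡ eval θ (quot y as) (line θ y x) ⊕ proj as y ⊗ x
    eval-quot θ (a ∷ []) y x =
      solve 3 (λ a x y → a :* x :+ con (+ 0) := con (+ 0) :+ (a :+ y :* con (+ 0)) :* x) refl a x y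
    eval-quot θ (a ∷ b ∷ bs) y x = begin
      a ⊗ x ⊕ eval θ (b ∷ bs) (θ ⊗ σ x)
        ≡⟨ cong (a ⊗ x ⊕_) (eval-quot θ (b ∷ bs) (σ y) (θ ⊗ σ x)) ⟩
      a ⊗ x ⊕ (eval θ qs (line θ (σ y) (θ ⊗ σ x)) ⊕ ρ ⊗ (θ ⊗ σ x))
        ≡⟨ cong (λ u → a ⊗ x ⊕ (eval θ qs u ⊕ ρ ⊗ (θ ⊗ σ x))) commute ⟩
      a ⊗ x ⊕ (eval θ qs (θ ⊗ σ (line θ y x)) ⊕ ρ ⊗ (θ ⊗ σ x))
        ≡⟨ solve 6 (λ a x y e ρ t → a :* x :+ (e :+ ρ :* t) := ρ :* (t :- y :* x) :+ e :+ (a :+ y :* ρ) :* x) refl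
             a x y _ ρ (θ ⊗ σ x) ⟩
      ρ ⊗ line θ y x ⊕ eval θ qs (θ ⊗ σ (line θ y x)) ⊕ (a ⊕ y ⊗ ρ) ⊗ x ∎
      where
      open ≡-Reasoning
      qs = quot (σ y) (b ∷ bs)
      ρ = proj (b ∷ bs) (σ y)
      -- The operator form of (X - σ(y)) X = X (X - y).
      commute : line θ (σ y) (θ ⊗ σ x) ≡ θ ⊗ σ (line θ y x)
      commute = begin
        θ ⊗ σ (θ ⊗ σ x) ⊕ ⊖ (σ y ⊗ (θ ⊗ σ x))
          ≡⟨ solve 4 (λ θ s y x → θ :* s :- y :* (θ :* x) := θ :* (s :- y :* x)) refl θ (σ (θ ⊗ σ x)) (σ y) (σ x) ⟩
        θ ⊗ (σ (θ ⊗ σ x) ⊕ ⊖ (σ y ⊗ σ x))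
          ≡⟨ cong (λ u → θ ⊗ (σ (θ ⊗ σ x) ⊕ u)) (trans (cong ⊖_ (sym (σ-⊗ y x))) (sym (σ-⊖ (y ⊗ x)))) ⟩
        θ ⊗ (σ (θ ⊗ σ x) ⊕ σ (⊖ (y ⊗ x)))
          ≡⟨ cong (θ ⊗_) (σ-⊕ _ _) ⟨
        θ ⊗ σ (line θ y x) ∎

    eval-on-line : ∀ {n} θ (as : Vec Carrier (suc n)) y x → line θ y x ≡ 0# → eval θ as x ≡ proj as y ⊗ x
    eval-on-line θ as y x eq = begin
      eval θ as x                                          ≡⟨ eval-quot θ as y x ⟩
      eval θ (quot y as) (line θ y x) ⊕ proj as y ⊗ x      ≡⟨ cong (λ u → eval θ (quot y as) u ⊕ proj as y ⊗ x) eq ⟩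
      eval θ (quot y as) 0# ⊕ proj as y ⊗ x                ≡⟨ cong (_⊕ proj as y ⊗ x) (eval-0 θ (quot y as)) ⟩
      0# ⊕ proj as y ⊗ x                                   ≡⟨ +-identityˡ _ ⟩
      proj as y ⊗ x                                        ∎
      where open ≡-Reasoning

    -- For nonzero `x`, the unique y such that X - y kills `x`.
    slope : Carrier → Carrier → Carrier
    slope θ x = θ ⊗ σ x ⊗ x ⁻¹

    line-slope : ∀ {θ x y} → x ≢ 0# → slope θ x ≡ y → line θ y x ≡ 0#
    line-slope {θ} {x} x≢0 refl = trans (cong (λ u → θ ⊗ σ x ⊕ ⊖ u) (/-⊗ x≢0)) (-‿inverseʳ _)

    slope-line : ∀ {θ x y} → x ≢ 0# → line θ y x ≡ 0# → slope θ x ≡ y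
    slope-line {θ} {x} {y} x≢0 eq = ⊗-cancelˡ x≢0 (trans (inverse-cancel x≢0 _) (trans (⊕-cancel-≡0 eq) (*-comm y x)))

    -- For a nonzero `u` in the kernel, θσ(x) = y x and θσ(u) = y u give σ(x/u) = x/u, so division
    -- by `u` embeds the kernel into the fixed field of σ.
    count-line-≤ : ∀ θ y → θ ≢ 0# → count (kernel (line θ y)) ≤ q
    count-line-≤ θ y θ≢0 with search (λ x → ¬? (0# ≟ x) ×-dec kernel (line θ y) x)
    ... | no none = ℕ.≤-trans (count-subsingleton (kernel (line θ y)) (λ u v p p′ → trans (zero-only u p) (sym (zero-only v p′)))) (s≤s z≤n)
      where
      zero-only : ∀ u → line θ y u ≡ 0# → u ≡ 0#
      zero-only u p with 0# ≟ u
      ... | yes 0≡u = sym 0≡u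
      ... | no 0≢u  = contradiction (u , 0≢u , p) none
    ... | yes (u , 0≢u , pu) = ℕ.≤-trans
      (count-injective (kernel (line θ y)) (λ x → σ x ≟ x) (_⊗ u ⁻¹) fixed
        (λ x x′ _ _ eq → trans (sym (/-⊗ u≢0)) (trans (cong (_⊗ u) eq) (/-⊗ u≢0))))
      count-fixed
      where
      u≢0 : u ≢ 0#
      u≢0 = 0≢u ∘ sym
      fixed : ∀ x → line θ y x ≡ 0# → σ (x ⊗ u ⁻¹) ≡ x ⊗ u ⁻¹
      fixed x px = ⊗-cancelˡ (⊗-≢0 θ≢0 (σ-≢0 u≢0)) (begin
        θ ⊗ σ u ⊗ σ (x ⊗ u ⁻¹)    ≡⟨ *-assoc θ _ _ ⟩
        θ ⊗ (σ u ⊗ σ (x ⊗ u ⁻¹))  ≡⟨ cong (θ ⊗_) (trans (sym (σ-⊗ _ _)) (cong σ (inverse-cancel u≢0 x))) ⟩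
        θ ⊗ σ x                   ≡⟨ ⊕-cancel-≡0 px ⟩
        y ⊗ x                     ≡⟨ cong (y ⊗_) (inverse-cancel u≢0 x) ⟨
        y ⊗ (u ⊗ (x ⊗ u ⁻¹))      ≡⟨ *-assoc y _ _ ⟨
        y ⊗ u ⊗ (x ⊗ u ⁻¹)        ≡⟨ cong (_⊗ (x ⊗ u ⁻¹)) (⊕-cancel-≡0 pu) ⟨
        θ ⊗ σ u ⊗ (x ⊗ u ⁻¹)      ∎)
        where open ≡-Reasoning

    -- A nonzero kernel element `u` makes X - `slope θ u` a right divisor. Then `line` maps the
    -- kernel into that of the quotient, one degree lower, with fibres of at most q elements.
    -- Without such a `u` the kernel is just 0.
    count-kernel-≤ : ∀ {n} θ (as : Vec Carrier (suc n)) → θ ≢ 0# → ¬ All (_≡ 0#) as → count (kernel (eval θ as)) ≤ q ^ n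
    count-kernel-≤ {n} θ as θ≢0 as≢0 with search (λ x → ¬? (0# ≟ x) ×-dec kernel (eval θ as) x)
    ... | no none = ℕ.≤-trans (count-subsingleton (kernel (eval θ as)) (λ u v p p′ → trans (zero-only u p) (sym (zero-only v p′)))) (ℕ.m^n>0 q n)
      where
      zero-only : ∀ u → eval θ as u ≡ 0# → u ≡ 0#
      zero-only u p with 0# ≟ u
      ... | yes 0≡u = sym 0≡u
      ... | no 0≢u  = contradiction (u , 0≢u , p) none
    ... | yes (u , 0≢u , pu) = divide as as≢0 root
      where
      u≢0 : u ≢ 0#
      u≢0 = 0≢u ∘ sym
      y = slope θ u
      root : proj as y ≡ 0#
      root = ⊗-≡0 u≢0 (trans (*-comm u _) (trans (sym (eval-on-line θ as y u (line-slope u≢0 refl))) pu))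
      divide : ∀ {n} (as : Vec Carrier (suc n)) → ¬ All (_≡ 0#) as → proj as y ≡ 0# → count (kernel (eval θ as)) ≤ q ^ n
      divide {zero} as@(_ ∷ []) as≢0 root = contradiction (quot-zero y as root []) as≢0
      divide {suc n} as as≢0 root = begin
        count (kernel (eval θ as))
          ≤⟨ count-≤-image*kernel (kernel (eval θ as)) (kernel (eval θ (quot y as))) (line θ y) (line-sub θ y) factor ⟩
        count (kernel (eval θ (quot y as))) * count (kernel (line θ y))
          ≤⟨ ℕ.*-mono-≤ (count-kernel-≤ θ (quot y as) θ≢0 (as≢0 ∘ quot-zero y as root)) (count-line-≤ θ y θ≢0) ⟩
        q ^ n * q  ≡⟨ ℕ.*-comm (q ^ n) q ⟩
        q ^ suc n  ∎
        where
        open ℕ.≤-Reasoning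
        factor : ∀ x → eval θ as x ≡ 0# → eval θ (quot y as) (line θ y x) ≡ 0#
        factor x eq = trans (sym (trans (cong (eval θ (quot y as) (line θ y x) ⊕_) (trans (cong (_⊗ x) root) (zeroˡ x))) (+-identityʳ _)))
          (trans (sym (eval-quot θ as y x)) eq)

    norm-⊗ : ∀ x y → norm (x ⊗ y) ≡ norm x ⊗ norm y
    norm-⊗ x y = trans
      (cong₂ _⊗_ (cong₂ _⊗_ (cong₂ _⊗_ (cong (x ⊗ y ⊗_) (σ-⊗ x y)) σσ) σσσ) (trans (cong σ σσσ) (σ-⊗ _ _)))
      (solve 10 (λ a b c d e f g h i j → a :* b :* (c :* d) :* (e :* f) :* (g :* h) :* (i :* j) := (a :* c :* e :* g :* i) :* (b :* d :* f :* h :* j))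
        refl x y (σ x) (σ y) (σ (σ x)) (σ (σ y)) (σ (σ (σ x))) (σ (σ (σ y))) (σ (σ (σ (σ x)))) (σ (σ (σ (σ y)))))
      where
      σσ : σ (σ (x ⊗ y)) ≡ σ (σ x) ⊗ σ (σ y)
      σσ = trans (cong σ (σ-⊗ x y)) (σ-⊗ _ _)
      σσσ : σ (σ (σ (x ⊗ y))) ≡ σ (σ (σ x)) ⊗ σ (σ (σ y))
      σσσ = trans (cong σ σσ) (σ-⊗ _ _)

    norm-σ : ∀ x → norm (σ x) ≡ norm x
    norm-σ x = trans (cong (σ x ⊗ σ (σ x) ⊗ σ (σ (σ x)) ⊗ σ (σ (σ (σ x))) ⊗_) (σ⁵ x))
      (solve 5 (λ a b c d e → b :* c :* d :* e :* a := a :* b :* c :* d :* e) refl x (σ x) (σ (σ x)) (σ (σ (σ x))) (σ (σ (σ (σ x)))))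

    -- Since σ⁵ is the identity, X⁵ acts on K as the scalar N(θ), so X⁵ - N(θ) annihilates K.
    twist⁵ : ∀ θ x → θ ⊗ σ (θ ⊗ σ (θ ⊗ σ (θ ⊗ σ (θ ⊗ σ x)))) ≡ norm θ ⊗ x
    twist⁵ θ x = begin
      τ (τ (τ (τ (τ x))))
        ≡⟨ cong (λ u → τ (τ (τ u))) (cong (θ ⊗_) (σ-⊗ θ (σ x))) ⟩
      τ (τ (τ (θ ⊗ (σ θ ⊗ σ (σ x)))))
        ≡⟨ cong (λ u → τ (τ (θ ⊗ u))) (trans (σ-⊗ _ _) (cong (σ θ ⊗_) (σ-⊗ _ _))) ⟩
      τ (τ (θ ⊗ (σ θ ⊗ (σ (σ θ) ⊗ σ (σ (σ x))))))
        ≡⟨ cong (λ u → τ (θ ⊗ u)) (trans (σ-⊗ _ _) (cong (σ θ ⊗_) (trans (σ-⊗ _ _) (cong (σ (σ θ) ⊗_) (σ-⊗ _ _))))) ⟩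
      τ (θ ⊗ (σ θ ⊗ (σ (σ θ) ⊗ (σ (σ (σ θ)) ⊗ σ (σ (σ (σ x)))))))
        ≡⟨ cong (θ ⊗_) (trans (σ-⊗ _ _) (cong (σ θ ⊗_) (trans (σ-⊗ _ _) (cong (σ (σ θ) ⊗_)
            (trans (σ-⊗ _ _) (cong (σ (σ (σ θ)) ⊗_) (trans (σ-⊗ _ _) (cong (σ (σ (σ (σ θ))) ⊗_) (σ⁵ x))))))))) ⟩
      θ ⊗ (σ θ ⊗ (σ (σ θ) ⊗ (σ (σ (σ θ)) ⊗ (σ (σ (σ (σ θ))) ⊗ x))))
        ≡⟨ solve 6 (λ a b c d e x → a :* (b :* (c :* (d :* (e :* x)))) := a :* b :* c :* d :* e :* x) refl
             θ (σ θ) (σ (σ θ)) (σ (σ (σ θ))) (σ (σ (σ (σ θ)))) x ⟩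
      norm θ ⊗ x ∎
      where
      open ≡-Reasoning
      τ : Carrier → Carrier
      τ x = θ ⊗ σ x

    X⁵-_ : Carrier → Vec Carrier 6
    X⁵- c = ⊖ c ∷ 0# ∷ 0# ∷ 0# ∷ 0# ∷ 1# ∷ []

    eval-X⁵- : ∀ θ c x → eval θ (X⁵- c) x ≡ norm θ ⊗ x ⊕ ⊖ (c ⊗ x)
    eval-X⁵- θ c x = trans
      (solve 7 (λ c x₀ x₁ x₂ x₃ x₄ x₅ → :- c :* x₀ :+ (o :* x₁ :+ (o :* x₂ :+ (o :* x₃ :+ (o :* x₄ :+ (con (+ 1) :* x₅ :+ o))))) := x₅ :- c :* x₀) refl
        c x (θ ⊗ σ x) (θ ⊗ σ (θ ⊗ σ x)) (θ ⊗ σ (θ ⊗ σ (θ ⊗ σ x))) (θ ⊗ σ (θ ⊗ σ (θ ⊗ σ (θ ⊗ σ x)))) (θ ⊗ σ (θ ⊗ σ (θ ⊗ σ (θ ⊗ σ (θ ⊗ σ x))))))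
      (cong (_⊕ ⊖ (c ⊗ x)) (twist⁵ θ x))
      where
      o : ∀ {n} → Polynomial n
      o = con (+ 0)

    -- Hence X - y divides X⁵ - c on the right exactly when c = N(y).
    proj-X⁵- : ∀ c y → proj (X⁵- c) y ≡ norm y ⊕ ⊖ c
    proj-X⁵- c y =
      solve 7 (λ c y₀ y₁ y₂ y₃ y₄ y₅ → :- c :+ y₀ :* (o :+ y₁ :* (o :+ y₂ :* (o :+ y₃ :* (o :+ y₄ :* (con (+ 1) :+ y₅ :* o))))) := y₀ :* y₁ :* y₂ :* y₃ :* y₄ :- c) refl
        c y (σ y) (σ (σ y)) (σ (σ (σ y))) (σ (σ (σ (σ y)))) (σ (σ (σ (σ (σ y)))))
      where
      o : ∀ {n} → Polynomial n
      o = con (+ 0)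

    -- The map `f` sends all of K into the kernel of `ms`, which has at most q^m elements, so the
    -- fibres of `f` cannot be small.
    count-kernel-≥ : ∀ {m} θ (ms : Vec Carrier (suc m)) → θ ≢ 0# → ¬ All (_≡ 0#) ms →
      (f : Carrier → Carrier) → (∀ x y → f (x ⊕ ⊖ y) ≡ f x ⊕ ⊖ f y) → (∀ x → eval θ ms (f x) ≡ 0#) →
      q ^ 5 ≤ q ^ m * count (kernel f)
    count-kernel-≥ {m} θ ms θ≢0 ms≢0 f f-sub killed = begin
      q ^ 5                                             ≡⟨ size≡q^5 ⟨
      size                                              ≡⟨ count-all (λ x → x ≟ x) (λ _ → refl) ⟨
      count (λ x → x ≟ x)
        ≤⟨ count-≤-image*kernel (λ x → x ≟ x) (kernel (eval θ ms)) f f-sub (λ x _ → killed x) ⟩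
      count (kernel (eval θ ms)) * count (kernel f)     ≤⟨ ℕ.*-monoˡ-≤ _ (count-kernel-≤ θ ms θ≢0 ms≢0) ⟩
      q ^ m * count (kernel f)                          ∎
      where open ℕ.≤-Reasoning

    -- Hilbert 90: X − y is a right divisor of X⁵ − norm y, which vanishes on K.
    count-line : ∀ {θ y} → θ ≢ 0# → norm y ≡ norm θ → count (kernel (line θ y)) ≡ q
    count-line {θ} {y} θ≢0 same-norm = ℕ.≤-antisym (count-line-≤ θ y θ≢0)
      (ℕ.*-cancelˡ-≤ (q ^ 4) {{ℕ.m^n≢0 q 4}} (ℕ.≤-trans (ℕ.≤-reflexive (ℕ.*-comm (q ^ 4) q))
        (count-kernel-≥ θ (quot y (X⁵- norm y)) θ≢0 quot≢0 (line θ y) (line-sub θ y) killed)))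
      where
      open ≡-Reasoning
      quot≢0 : ¬ All (_≡ 0#) (quot y (X⁵- norm y))
      quot≢0 (_ ∷ _ ∷ _ ∷ _ ∷ top≡0 ∷ []) = 0≢1 (sym (trans (solve 1 (λ y → con (+ 1) := con (+ 1) :+ y :* con (+ 0)) refl _) top≡0))
      killed : ∀ x → eval θ (quot y (X⁵- norm y)) (line θ y x) ≡ 0#
      killed x = begin
        e                                           ≡⟨ solve 2 (λ e t → e := e :+ t :- t) refl e (proj (X⁵- norm y) y ⊗ x) ⟩
        e ⊕ ρ ⊗ x ⊕ ⊖ (ρ ⊗ x)                       ≡⟨ cong (_⊕ ⊖ (ρ ⊗ x)) (eval-quot θ (X⁵- norm y) y x) ⟨
        eval θ (X⁵- norm y) x ⊕ ⊖ (ρ ⊗ x)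
          ≡⟨ cong₂ (λ u v → u ⊕ ⊖ (v ⊗ x)) (eval-X⁵- θ (norm y) x) (proj-X⁵- (norm y) y) ⟩
        norm θ ⊗ x ⊕ ⊖ (norm y ⊗ x) ⊕ ⊖ ((norm y ⊕ ⊖ norm y) ⊗ x)
                                                    ≡⟨ cong (λ c → c ⊗ x ⊕ ⊖ (norm y ⊗ x) ⊕ ⊖ ((norm y ⊕ ⊖ norm y) ⊗ x)) same-norm ⟨
        norm y ⊗ x ⊕ ⊖ (norm y ⊗ x) ⊕ ⊖ ((norm y ⊕ ⊖ norm y) ⊗ x)
                                                    ≡⟨ solve 2 (λ c x → c :* x :- c :* x :- (c :- c) :* x := con (+ 0)) refl (norm y) x ⟩
        0#                                          ∎
        where
        e = eval θ (quot y (X⁵- norm y)) (line θ y x)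
        ρ = proj (X⁵- norm y) y

    rootWithNorm? : ∀ {n} (as : Vec Carrier n) c → Decidable (λ y → proj as y ≡ 0# × norm y ≡ c)
    rootWithNorm? as c y = (proj as y ≟ 0#) ×-dec (norm y ≟ c)

    -- x ↦ θ σ(x) / x maps the nonzero kernel onto the roots of norm N(θ), with fibres of size q − 1.
    count-kernel : ∀ {n} θ (as : Vec Carrier (suc n)) → θ ≢ 0# →
      count (kernel (eval θ as)) ≡ suc (count (rootWithNorm? as (norm θ)) * r)
    count-kernel θ as θ≢0 = trans (count-split (kernel (eval θ as)) 0# (eval-0 θ as)) (cong suc (ℕ.≤-antisym
      (count-fibre-≤ A? (slope θ) Z? r slope∈Z (λ b bZ → ℕ.≤-reflexive (fibre b bZ)))
      (count-fibre-≥ A? (slope θ) Z? r (λ b bZ → ℕ.≤-reflexive (sym (fibre b bZ))))))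
      where
      A? = λ x → ¬? (0# ≟ x) ×-dec kernel (eval θ as) x
      Z? = rootWithNorm? as (norm θ)
      slope∈Z : ∀ x → (0# ≢ x × eval θ as x ≡ 0#) → proj as (slope θ x) ≡ 0# × norm (slope θ x) ≡ norm θ
      slope∈Z x (0≢x , ex≡0) =
        ⊗-≡0 x≢0 (trans (*-comm x _) (trans (sym (eval-on-line θ as y x on-line)) ex≡0)) ,
        ⊗-cancelˡ (norm-≢0 x≢0) (begin
          norm x ⊗ norm y        ≡⟨ *-comm _ _ ⟩
          norm y ⊗ norm x        ≡⟨ norm-⊗ y x ⟨
          norm (y ⊗ x)           ≡⟨ cong norm (⊕-cancel-≡0 on-line) ⟨
          norm (θ ⊗ σ x)         ≡⟨ norm-⊗ θ (σ x) ⟩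
          norm θ ⊗ norm (σ x)    ≡⟨ cong (norm θ ⊗_) (norm-σ x) ⟩
          norm θ ⊗ norm x        ≡⟨ *-comm _ _ ⟩
          norm x ⊗ norm θ        ∎)
        where
        open ≡-Reasoning
        x≢0 = 0≢x ∘ sym
        y = slope θ x
        on-line = line-slope {θ} {x} x≢0 refl
      fibre : ∀ b → (proj as b ≡ 0# × norm b ≡ norm θ) → count-fibre A? (slope θ) b ≡ r
      fibre b (pb≡0 , nb≡nθ) = ℕ.suc-injective (begin
        suc (count-fibre A? (slope θ) b)
          ≡⟨ cong suc (count-cong (λ x → A? x ×-dec (slope θ x ≟ b)) (λ x → ¬? (0# ≟ x) ×-dec kernel (line θ b) x) to-line from-line) ⟩
        suc (count (λ x → ¬? (0# ≟ x) ×-dec kernel (line θ b) x))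
          ≡⟨ count-split (kernel (line θ b)) 0# line-0 ⟨
        count (kernel (line θ b))
          ≡⟨ count-line θ≢0 nb≡nθ ⟩
        suc r ∎)
        where
        open ≡-Reasoning
        line-0 : line θ b 0# ≡ 0#
        line-0 = trans (cong (λ u → θ ⊗ u ⊕ ⊖ (b ⊗ 0#)) σ-0) (solve 2 (λ θ b → θ :* con (+ 0) :- b :* con (+ 0) := con (+ 0)) refl θ b)
        to-line : ∀ x → ((0# ≢ x × eval θ as x ≡ 0#) × slope θ x ≡ b) → 0# ≢ x × line θ b x ≡ 0#
        to-line x ((0≢x , _) , slope≡b) = 0≢x , line-slope (0≢x ∘ sym) slope≡b
        from-line : ∀ x → (0# ≢ x × line θ b x ≡ 0#) → (0# ≢ x × eval θ as x ≡ 0#) × slope θ x ≡ b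
        from-line x (0≢x , on-line) =
          (0≢x , trans (eval-on-line θ as b x on-line) (trans (cong (_⊗ x) pb≡0) (zeroˡ x))) , slope-line (0≢x ∘ sym) on-line

    ⊖-involutive : ∀ x → ⊖ (⊖ x) ≡ x
    ⊖-involutive = solve 1 (λ x → :- (:- x) := x) refl

    ⊖-≢0 : ∀ {x} → x ≢ 0# → ⊖ x ≢ 0#
    ⊖-≢0 {x} x≢0 eq = x≢0 (trans (sym (⊖-involutive x)) (trans (cong ⊖_ eq) (solve 0 (:- con (+ 0) := con (+ 0)) refl)))

    twist-⊗ : ∀ θ a x → θ ⊗ σ (a ⊗ x) ≡ σ a ⊗ (θ ⊗ σ x)
    twist-⊗ θ a x = trans (cong (θ ⊗_) (σ-⊗ a x)) (solve 3 (λ θ a x → θ :* (a :* x) := a :* (θ :* x)) refl θ (σ a) (σ x))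

    -- The rule X a = σ(a) X, coefficient by coefficient. It carries X past the cubic when the
    -- product `quotient` · `ℓ` is expanded.
    twist-eval : ∀ {n} θ (as : Vec Carrier n) x → θ ⊗ σ (eval θ as x) ≡ eval θ (map σ as) (θ ⊗ σ x)
    twist-eval θ []       x = trans (cong (θ ⊗_) σ-0) (zeroʳ θ)
    twist-eval θ (a ∷ as) x = trans (twist-⊕ θ _ _) (cong₂ _⊕_ (twist-⊗ θ a x) (twist-eval θ as (θ ⊗ σ x)))

    eval-zero : ∀ {n} θ {as : Vec Carrier n} → All (_≡ 0#) as → ∀ x → eval θ as x ≡ 0#
    eval-zero θ []             x = refl
    eval-zero θ (refl ∷ zeros) x = trans (cong (0# ⊗ x ⊕_) (eval-zero θ zeros _)) (trans (+-identityʳ _) (zeroˡ x))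

    proj-zero : ∀ {n} {as : Vec Carrier n} → All (_≡ 0#) as → ∀ y → proj as y ≡ 0#
    proj-zero []             y = refl
    proj-zero (refl ∷ zeros) y = trans (+-identityˡ _) (trans (cong (y ⊗_) (proj-zero zeros _)) (zeroʳ y))

    -- For θ = y the operator X - y kills 1. Through this case identities between operators become
    -- identities between values of `proj`.
    eval-self : ∀ {n} (as : Vec Carrier (suc n)) y → eval y as 1# ≡ proj as y
    eval-self as y = trans (eval-on-line y as y 1# (trans (cong (λ u → y ⊗ u ⊕ ⊖ (y ⊗ 1#)) σ-1) (-‿inverseʳ _))) (*-identityʳ _)

    norm-1 : norm 1# ≡ 1#
    norm-1 rewrite σ-1 | σ-1 | σ-1 | σ-1 = solve 0 (con (+ 1) :* con (+ 1) :* con (+ 1) :* con (+ 1) :* con (+ 1) := con (+ 1)) refl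

    norm-⊖ : ∀ x → norm (⊖ x) ≡ ⊖ norm x
    norm-⊖ x = trans
      (cong₂ _⊗_ (cong₂ _⊗_ (cong₂ _⊗_ (cong (⊖ x ⊗_) (σ-⊖ x)) σσ) σσσ) (trans (cong σ σσσ) (σ-⊖ _)))
      (solve 5 (λ a b c d e → :- a :* :- b :* :- c :* :- d :* :- e := :- (a :* b :* c :* d :* e)) refl x (σ x) (σ (σ x)) (σ (σ (σ x))) (σ (σ (σ (σ x)))))
      where
      σσ : σ (σ (⊖ x)) ≡ ⊖ σ (σ x)
      σσ = trans (cong σ (σ-⊖ x)) (σ-⊖ _)
      σσσ : σ (σ (σ (⊖ x))) ≡ ⊖ σ (σ (σ x))
      σσσ = trans (cong σ σσ) (σ-⊖ _)

    -- Bounds the number of values that the norm takes on nonzero elements.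
    count-nonzero-fixed-≤ : count (λ x → ¬? (0# ≟ x) ×-dec (σ x ≟ x)) ≤ r
    count-nonzero-fixed-≤ = ℕ.s≤s⁻¹ (ℕ.≤-trans (ℕ.≤-reflexive (sym (count-split (λ x → σ x ≟ x) 0# σ-0))) count-fixed)

    -- Right division of X⁵ - c by a monic cubic

    module Cubic (α β γ : Carrier) where

      ℓ : Vec Carrier 4
      ℓ = γ ∷ β ∷ α ∷ 1# ∷ []

      -- The coefficients of the remainder of X⁵ on right division by `ℓ`. The bracket common to all
      -- three is the constant coefficient of `quotient`.
      r₀ r₁ r₂ : Carrier
      r₀ = ⊖ ((σ (σ α) ⊗ σ α ⊕ ⊖ σ (σ β)) ⊗ γ)
      r₁ = σ (σ α) ⊗ σ γ ⊕ ⊖ ((σ (σ α) ⊗ σ α ⊕ ⊖ σ (σ β)) ⊗ β)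
      r₂ = σ (σ α) ⊗ σ β ⊕ ⊖ σ (σ γ) ⊕ ⊖ ((σ (σ α) ⊗ σ α ⊕ ⊖ σ (σ β)) ⊗ α)

      quotient : Vec Carrier 3
      quotient = (σ (σ α) ⊗ σ α ⊕ ⊖ σ (σ β)) ∷ ⊖ σ (σ α) ∷ 1# ∷ []

      remainder : Carrier → Vec Carrier 3
      remainder c = (r₀ ⊕ ⊖ c) ∷ r₁ ∷ r₂ ∷ []

      quotient≢0 : ¬ All (_≡ 0#) quotient
      quotient≢0 (_ ∷ _ ∷ 1≡0 ∷ []) = 0≢1 (sym 1≡0)

      -- Once X and X² have been moved past the coefficients of `ℓ`, this is an identity linear in
      -- the iterates of `x` under θσ, which the solver treats as independent variables.
      division : ∀ θ c x → eval θ (X⁵- c) x ≡ eval θ quotient (eval θ ℓ x) ⊕ eval θ (remainder c) x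
      division θ c x = sym (begin
        eval θ quotient (eval θ ℓ x) ⊕ eval θ (remainder c) x
          ≡⟨ cong₂ (λ u v → m ⊗ eval θ ℓ x ⊕ (⊖ α₂ ⊗ u ⊕ (1# ⊗ v ⊕ 0#)) ⊕ eval θ (remainder c) x) once twice ⟩
        m ⊗ eval θ ℓ x ⊕ (⊖ α₂ ⊗ eval θ (σ γ ∷ β₁ ∷ α₁ ∷ 1# ∷ []) (τ x)
            ⊕ (1# ⊗ eval θ (σ (σ γ) ∷ β₂ ∷ α₂ ∷ 1# ∷ []) (τ (τ x)) ⊕ 0#)) ⊕ eval θ (remainder c) x
          ≡⟨ solve 16 (λ c α α₁ α₂ β β₁ β₂ γ γ₁ γ₂ x₀ x₁ x₂ x₃ x₄ x₅ →
               let m = α₂ :* α₁ :- β₂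
                   ev = λ g b a x y z t → g :* x :+ (b :* y :+ (a :* z :+ (i :* t :+ o)))
               in m :* ev γ β α x₀ x₁ x₂ x₃ :+ (:- α₂ :* ev γ₁ β₁ α₁ x₁ x₂ x₃ x₄ :+ (i :* ev γ₂ β₂ α₂ x₂ x₃ x₄ x₅ :+ o))
                  :+ ((:- (m :* γ) :- c) :* x₀ :+ ((α₂ :* γ₁ :- m :* β) :* x₁ :+ ((α₂ :* β₁ :- γ₂ :- m :* α) :* x₂ :+ o)))
                  := :- c :* x₀ :+ (o :* x₁ :+ (o :* x₂ :+ (o :* x₃ :+ (o :* x₄ :+ (i :* x₅ :+ o))))))
               refl c α α₁ α₂ β β₁ β₂ γ (σ γ) (σ (σ γ)) x (τ x) (τ (τ x)) (τ (τ (τ x))) (τ (τ (τ (τ x)))) (τ (τ (τ (τ (τ x))))) ⟩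
        eval θ (X⁵- c) x ∎)
        where
        open ≡-Reasoning
        τ : Carrier → Carrier
        τ x = θ ⊗ σ x
        α₁ = σ α
        α₂ = σ (σ α)
        β₁ = σ β
        β₂ = σ (σ β)
        m = α₂ ⊗ α₁ ⊕ ⊖ β₂
        i o : ∀ {n} → Polynomial n
        i = con (+ 1)
        o = con (+ 0)
        once : τ (eval θ ℓ x) ≡ eval θ (σ γ ∷ β₁ ∷ α₁ ∷ 1# ∷ []) (τ x)
        once = trans (twist-eval θ ℓ x) (cong (λ u → eval θ (σ γ ∷ β₁ ∷ α₁ ∷ u ∷ []) (τ x)) σ-1)
        twice : τ (τ (eval θ ℓ x)) ≡ eval θ (σ (σ γ) ∷ β₂ ∷ α₂ ∷ 1# ∷ []) (τ (τ x))
        twice = trans (cong τ once) (trans (twist-eval θ (σ γ ∷ β₁ ∷ α₁ ∷ 1# ∷ []) (τ x))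
          (cong (λ u → eval θ (σ (σ γ) ∷ β₂ ∷ α₂ ∷ u ∷ []) (τ (τ x))) σ-1))

      -- On the kernel of `ℓ` the polynomial X⁵ - c acts in two ways: as the scalar N(θ) - c, and as
      -- its remainder modulo `ℓ`.
      remainder-on-kernel : ∀ θ c x → eval θ ℓ x ≡ 0# → norm θ ⊗ x ⊕ ⊖ (c ⊗ x) ≡ eval θ (remainder c) x
      remainder-on-kernel θ c x ℓx≡0 = begin
        norm θ ⊗ x ⊕ ⊖ (c ⊗ x)                                  ≡⟨ eval-X⁵- θ c x ⟨
        eval θ (X⁵- c) x                                        ≡⟨ division θ c x ⟩
        eval θ quotient (eval θ ℓ x) ⊕ eval θ (remainder c) x
          ≡⟨ cong (λ u → eval θ quotient u ⊕ eval θ (remainder c) x) ℓx≡0 ⟩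
        eval θ quotient 0# ⊕ eval θ (remainder c) x             ≡⟨ cong (_⊕ eval θ (remainder c) x) (eval-0 θ quotient) ⟩
        0# ⊕ eval θ (remainder c) x                             ≡⟨ +-identityˡ _ ⟩
        eval θ (remainder c) x                                  ∎
        where open ≡-Reasoning

      -- A root `y` puts 1 into the kernel of `ℓ` when X acts as yσ, so θ = y and x = 1 can be taken
      -- in `remainder-on-kernel`.
      remainder-at-root : ∀ c y → proj ℓ y ≡ 0# → norm y ⊕ ⊖ c ≡ proj (remainder c) y
      remainder-at-root c y root = begin
        norm y ⊕ ⊖ c                       ≡⟨ cong₂ (λ u v → u ⊕ ⊖ v) (*-identityʳ (norm y)) (*-identityʳ c) ⟨
        norm y ⊗ 1# ⊕ ⊖ (c ⊗ 1#)           ≡⟨ remainder-on-kernel y c 1# (trans (eval-self ℓ y) root) ⟩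
        eval y (remainder c) 1#            ≡⟨ eval-self (remainder c) y ⟩
        proj (remainder c) y               ∎
        where open ≡-Reasoning

      -- Now `quotient` · `ℓ` = X⁵ - N(θ) annihilates K. Since `quotient` has degree 2, q⁵ ≤ q² |ker
      -- ℓ|, which meets the upper bound q³ from the degree of `ℓ`.
      remainder≡0⇒count-kernel : ∀ θ → θ ≢ 0# → All (_≡ 0#) (remainder (norm θ)) → count (kernel (eval θ ℓ)) ≡ q ^ 3
      remainder≡0⇒count-kernel θ θ≢0 R≡0 = ℕ.≤-antisym (count-kernel-≤ θ ℓ θ≢0 (λ { (_ ∷ _ ∷ _ ∷ 1≡0 ∷ []) → 0≢1 (sym 1≡0) }))
        (ℕ.*-cancelˡ-≤ (q ^ 2) {{ℕ.m^n≢0 q 2}} (ℕ.≤-trans (ℕ.≤-reflexive (sym (ℕ.^-distribˡ-+-* q 2 3)))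
          (count-kernel-≥ θ quotient θ≢0 quotient≢0 (eval θ ℓ) (eval-sub θ ℓ) killed)))
        where
        open ≡-Reasoning
        killed : ∀ x → eval θ quotient (eval θ ℓ x) ≡ 0#
        killed x = begin
          eval θ quotient (eval θ ℓ x)                                     ≡⟨ +-identityʳ _ ⟨
          eval θ quotient (eval θ ℓ x) ⊕ 0#
            ≡⟨ cong (eval θ quotient (eval θ ℓ x) ⊕_) (eval-zero θ R≡0 x) ⟨
          eval θ quotient (eval θ ℓ x) ⊕ eval θ (remainder (norm θ)) x     ≡⟨ division θ (norm θ) x ⟨
          eval θ (X⁵- norm θ) x                                            ≡⟨ eval-X⁵- θ (norm θ) x ⟩
          norm θ ⊗ x ⊕ ⊖ (norm θ ⊗ x)                                      ≡⟨ -‿inverseʳ _ ⟩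
          0#                                                               ∎

      -- A nonzero remainder has degree at most 2, and its kernel contains that of `ℓ`; this allows
      -- at most q² elements, fewer than q³ because q > 1.
      count-kernel⇒remainder≡0 : count (kernel (eval 1# ℓ)) ≡ q ^ 3 → All (_≡ 0#) (remainder 1#)
      count-kernel⇒remainder≡0 full with all? (_≟ 0#) (remainder 1#)
      ... | yes R≡0 = R≡0
      ... | no R≢0  = contradiction
        (ℕ.≤-trans (count-mono (kernel (eval 1# ℓ)) (kernel (eval 1# (remainder 1#))) on-kernel) (count-kernel-≤ 1# (remainder 1#) (0≢1 ∘ sym) R≢0))
        (ℕ.<⇒≱ (ℕ.<-≤-trans (ℕ.^-monoʳ-< q (s≤s 0<r) {2} {3} ℕ.≤-refl) (ℕ.≤-reflexive (sym full))))
        where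
        on-kernel : ∀ x → eval 1# ℓ x ≡ 0# → eval 1# (remainder 1#) x ≡ 0#
        on-kernel x ℓx≡0 = trans (sym (remainder-on-kernel 1# 1# x ℓx≡0))
          (trans (cong (λ c → c ⊗ x ⊕ ⊖ (1# ⊗ x)) norm-1) (-‿inverseʳ _))

      -- By `remainder-at-root` every root has norm N(θ), so the kernel of the single operator
      -- `eval θ ℓ` accounts for all roots.
      remainder≡0⇒count-roots : ∀ θ → θ ≢ 0# → All (_≡ 0#) (remainder (norm θ)) → count (λ y → proj ℓ y ≟ 0#) ≡ q ^ 2 + q + 1
      remainder≡0⇒count-roots θ θ≢0 R≡0 = ℕ.*-cancelʳ-≡ _ _ r {{ℕ.>-nonZero 0<r}} (ℕ.suc-injective (begin
        suc (count (λ y → proj ℓ y ≟ 0#) * r)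
          ≡⟨ cong (λ n → suc (n * r)) (count-cong (λ y → proj ℓ y ≟ 0#) (rootWithNorm? ℓ (norm θ)) has-norm (λ y → proj₁)) ⟩
        suc (count (rootWithNorm? ℓ (norm θ)) * r)            ≡⟨ count-kernel θ ℓ θ≢0 ⟨
        count (kernel (eval θ ℓ))                             ≡⟨ remainder≡0⇒count-kernel θ θ≢0 R≡0 ⟩
        q ^ 3                                                 ≡⟨ cube-1+r r ⟩
        suc ((q ^ 2 + q + 1) * r)                             ∎))
        where
        open ≡-Reasoning
        has-norm : ∀ y → proj ℓ y ≡ 0# → proj ℓ y ≡ 0# × norm y ≡ norm θ
        has-norm y root = root , ⊕-cancel-≡0 (trans (remainder-at-root (norm θ) y root) (proj-zero R≡0 y))

      -- Otherwise the roots of each norm c are roots of the nonzero quadratic remainder modulo X⁵ − c,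
      -- so there are at most q + 1 of them, while c takes at most q − 1 values.
      count-roots⇒r₁≡r₂≡0 : γ ≢ 0# → count (λ y → proj ℓ y ≟ 0#) ≡ q ^ 2 + q + 1 → r₁ ≡ 0# × r₂ ≡ 0#
      count-roots⇒r₁≡r₂≡0 γ≢0 full with (r₁ ≟ 0#) ×-dec (r₂ ≟ 0#)
      ... | yes zeros = zeros
      ... | no ¬zeros = contradiction few (ℕ.<⇒≱ many)
        where
        open ℕ.≤-Reasoning
        root≢0 : ∀ y → proj ℓ y ≡ 0# → y ≢ 0#
        root≢0 y root refl = γ≢0 (trans (solve 2 (λ g u → g := g :+ con (+ 0) :* u) refl γ (proj (β ∷ α ∷ 1# ∷ []) (σ 0#))) root)
        many : r * suc q < count (λ y → proj ℓ y ≟ 0#)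
        many = ℕ.<-≤-trans (r[2+r]<[1+r]²+[1+r]+1 r) (ℕ.≤-reflexive (sym full))
        fibre-≤ : ∀ c → count-fibre (λ y → proj ℓ y ≟ 0#) norm c ≤ suc q
        fibre-≤ c with search (rootWithNorm? ℓ c)
        ... | no none = ℕ.≤-trans (ℕ.≤-reflexive (count-none (rootWithNorm? ℓ c) (λ y p → none (y , p)))) z≤n
        -- A root of norm `c`, if there is one, serves itself as the twist θ for that norm.
        ... | yes (θ , root , refl) = ℕ.≤-trans
          (count-mono (rootWithNorm? ℓ c) (rootWithNorm? (remainder c) c) (λ y (pℓ≡0 , ny≡c) →
            trans (sym (remainder-at-root c y pℓ≡0)) (trans (cong (_⊕ ⊖ c) ny≡c) (-‿inverseʳ c)) , ny≡c))
          (ℕ.*-cancelʳ-≤ _ (suc q) r {{ℕ.>-nonZero 0<r}} (ℕ.s≤s⁻¹ (begin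
            suc (count (rootWithNorm? (remainder c) c) * r)    ≡⟨ count-kernel θ (remainder c) θ≢0 ⟨
            count (kernel (eval θ (remainder c)))
              ≤⟨ count-kernel-≤ θ (remainder c) θ≢0 (λ { (_ ∷ r₁≡0 ∷ r₂≡0 ∷ []) → ¬zeros (r₁≡0 , r₂≡0) }) ⟩
            q ^ 2                                              ≡⟨ square-1+r r ⟩
            suc (suc q * r)                                    ∎)))
          where θ≢0 = root≢0 θ root
        few : count (λ y → proj ℓ y ≟ 0#) ≤ r * suc q
        few = ℕ.≤-trans
          (count-fibre-≤ (λ y → proj ℓ y ≟ 0#) norm (λ c → ¬? (0# ≟ c) ×-dec (σ c ≟ c)) (suc q)
            (λ y root → (λ 0≡ny → norm-≢0 (root≢0 y root) (sym 0≡ny)) , σ-norm y) (λ c _ → fibre-≤ c))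
          (ℕ.*-monoˡ-≤ (suc q) count-nonzero-fixed-≤)

      -- The remainder in terms of z and w

      module Invariants (α≢0 : α ≢ 0#) (γ≢0 : γ ≢ 0#) (z w : Carrier)
        (z-def : z ⊗ (α ⊗ σ α) ≡ σ β) (w-def : w ⊗ (β ⊗ σ β) ≡ σ γ ⊗ α) where

        α₁ α₂ α₃ α₄ z₁ z₂ z₃ z₄ : Carrier
        α₁ = σ α
        α₂ = σ α₁
        α₃ = σ α₂
        α₄ = σ α₃
        z₁ = σ z
        z₂ = σ z₁
        z₃ = σ z₂
        z₄ = σ z₃

        e₁ e₂ : Carrier
        e₁ = z₂ ⊗ z ⊕ z₁ ⊕ ⊖ 1#
        e₂ = z₁ ⊕ z ⊕ ⊖ 1# ⊕ ⊖ (σ w ⊗ (z ⊗ z₁))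

        α₁≢0 : α₁ ≢ 0#
        α₁≢0 = σ-≢0 α≢0
        α₂≢0 : α₂ ≢ 0#
        α₂≢0 = σ-≢0 α₁≢0
        α₃≢0 : α₃ ≢ 0#
        α₃≢0 = σ-≢0 α₂≢0

        β₂ : σ (σ β) ≡ z₁ ⊗ (α₁ ⊗ α₂)
        β₂ = trans (cong σ (sym z-def)) (trans (σ-⊗ _ _) (cong (z₁ ⊗_) (σ-⊗ _ _)))

        β₃ : σ (σ (σ β)) ≡ z₂ ⊗ (α₂ ⊗ α₃)
        β₃ = trans (cong σ β₂) (trans (σ-⊗ _ _) (cong (z₂ ⊗_) (σ-⊗ _ _)))

        -- Applying σ to `w-def` leaves only σ(β) and σ²(β), both of which z expresses through the
        -- conjugates of α; one factor `α₁` then cancels.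
        γ₂ : σ (σ γ) ≡ σ w ⊗ z ⊗ z₁ ⊗ α ⊗ α₁ ⊗ α₂
        γ₂ = ⊗-cancelˡ α₁≢0 (begin
          α₁ ⊗ σ (σ γ)                                        ≡⟨ *-comm _ _ ⟩
          σ (σ γ) ⊗ α₁                                        ≡⟨ σ-⊗ _ _ ⟨
          σ (σ γ ⊗ α)                                         ≡⟨ cong σ w-def ⟨
          σ (w ⊗ (β ⊗ σ β))                                   ≡⟨ trans (σ-⊗ _ _) (cong (σ w ⊗_) (σ-⊗ _ _)) ⟩
          σ w ⊗ (σ β ⊗ σ (σ β))                               ≡⟨ cong₂ (λ u v → σ w ⊗ (u ⊗ v)) (sym z-def) β₂ ⟩
          σ w ⊗ (z ⊗ (α ⊗ α₁) ⊗ (z₁ ⊗ (α₁ ⊗ α₂)))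
            ≡⟨ solve 6 (λ w z z₁ a a₁ a₂ → w :* (z :* (a :* a₁) :* (z₁ :* (a₁ :* a₂))) := a₁ :* (w :* z :* z₁ :* a :* a₁ :* a₂)) refl (σ w) z z₁ α α₁ α₂ ⟩
          α₁ ⊗ (σ w ⊗ z ⊗ z₁ ⊗ α ⊗ α₁ ⊗ α₂)                   ∎)
          where open ≡-Reasoning

        r₂≡ : r₂ ≡ α ⊗ α₁ ⊗ α₂ ⊗ e₂
        r₂≡ = trans
          (cong₂ (λ u v → u ⊕ ⊖ ((α₂ ⊗ α₁ ⊕ ⊖ v) ⊗ α)) (cong₂ (λ u v → α₂ ⊗ u ⊕ ⊖ v) (sym z-def) γ₂) β₂)
          (solve 6 (λ a a₁ a₂ z z₁ w → a₂ :* (z :* (a :* a₁)) :- w :* z :* z₁ :* a :* a₁ :* a₂ :- (a₂ :* a₁ :- z₁ :* (a₁ :* a₂)) :* a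
                      := a :* a₁ :* a₂ :* (z₁ :+ z :- con (+ 1) :- w :* (z :* z₁))) refl α α₁ α₂ z z₁ (σ w))

        -- The coefficient `r₁` contains β itself, so it is first shifted by σ. Adding `α₃ ⊗ r₂`
        -- cancels the terms in σ²(γ), and with them w, leaving a multiple of `e₁`.
        σr₁≡ : σ r₁ ⊕ α₃ ⊗ r₂ ≡ α ⊗ α₁ ⊗ α₂ ⊗ α₃ ⊗ e₁
        σr₁≡ = trans
          (cong (_⊕ α₃ ⊗ r₂) (trans (σ-⊕ _ _) (cong₂ _⊕_ (σ-⊗ _ _) (trans (σ-⊖ _) (cong ⊖_ (trans (σ-⊗ _ _) (cong (_⊗ σ β)
            (trans (σ-⊕ _ _) (cong₂ _⊕_ (σ-⊗ _ _) (trans (σ-⊖ _) (cong ⊖_ β₃)))))))))))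
          (trans
            (cong₂ (λ u v → α₃ ⊗ σ (σ γ) ⊕ ⊖ ((α₃ ⊗ α₂ ⊕ ⊖ (z₂ ⊗ (α₂ ⊗ α₃))) ⊗ u)
                ⊕ α₃ ⊗ (α₂ ⊗ u ⊕ ⊖ σ (σ γ) ⊕ ⊖ ((α₂ ⊗ α₁ ⊕ ⊖ v) ⊗ α))) (sym z-def) β₂)
            (solve 8 (λ a a₁ a₂ a₃ z z₁ z₂ g → a₃ :* g :- (a₃ :* a₂ :- z₂ :* (a₂ :* a₃)) :* (z :* (a :* a₁))
                        :+ a₃ :* (a₂ :* (z :* (a :* a₁)) :- g :- (a₂ :* a₁ :- z₁ :* (a₁ :* a₂)) :* a)
                        := a :* a₁ :* a₂ :* a₃ :* (z₂ :* z :+ z₁ :- con (+ 1))) refl α α₁ α₂ α₃ z z₁ z₂ (σ (σ γ))))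

        e≡0⇒r≡0 : e₁ ≡ 0# → e₂ ≡ 0# → r₁ ≡ 0# × r₂ ≡ 0#
        e≡0⇒r≡0 e₁≡0 e₂≡0 = σ-injective (trans σr₁≡0 (sym σ-0)) , r₂≡0
          where
          open ≡-Reasoning
          r₂≡0 : r₂ ≡ 0#
          r₂≡0 = trans r₂≡ (trans (cong (α ⊗ α₁ ⊗ α₂ ⊗_) e₂≡0) (zeroʳ _))
          σr₁≡0 : σ r₁ ≡ 0#
          σr₁≡0 = begin
            σ r₁                            ≡⟨ solve 2 (λ s a → s := s :+ a :* con (+ 0)) refl (σ r₁) α₃ ⟩
            σ r₁ ⊕ α₃ ⊗ 0#                  ≡⟨ cong (λ u → σ r₁ ⊕ α₃ ⊗ u) r₂≡0 ⟨
            σ r₁ ⊕ α₃ ⊗ r₂                  ≡⟨ σr₁≡ ⟩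
            α ⊗ α₁ ⊗ α₂ ⊗ α₃ ⊗ e₁           ≡⟨ trans (cong (α ⊗ α₁ ⊗ α₂ ⊗ α₃ ⊗_) e₁≡0) (zeroʳ _) ⟩
            0#                              ∎

        r≡0⇒e≡0 : r₁ ≡ 0# → r₂ ≡ 0# → e₁ ≡ 0# × e₂ ≡ 0#
        r≡0⇒e≡0 r₁≡0 r₂≡0 =
          ⊗-≡0 (⊗-≢0 ααα≢0 α₃≢0) (trans (sym σr₁≡) (trans (cong₂ (λ u v → u ⊕ α₃ ⊗ v) (trans (cong σ r₁≡0) σ-0) r₂≡0)
            (solve 1 (λ a → con (+ 0) :+ a :* con (+ 0) := con (+ 0)) refl α₃))) ,
          ⊗-≡0 ααα≢0 (trans (sym r₂≡) r₂≡0)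
          where
          ααα≢0 : α ⊗ α₁ ⊗ α₂ ≢ 0#
          ααα≢0 = ⊗-≢0 (⊗-≢0 α≢0 α₁≢0) α₂≢0

        module _ (e₁≡0 : e₁ ≡ 0#) (e₂≡0 : e₂ ≡ 0#) where

          σe₁≡0 : z₃ ⊗ z₁ ⊕ z₂ ⊕ ⊖ 1# ≡ 0#
          σe₁≡0 = trans (sym (trans (σ-⊕ _ _) (cong₂ _⊕_ (trans (σ-⊕ _ _) (cong (_⊕ z₂) (σ-⊗ z₂ z))) (trans (σ-⊖ 1#) (cong ⊖_ σ-1)))))
            (trans (cong σ e₁≡0) σ-0)

          -- Eliminates w: `e₂` gives σ(w) z z₁ = z + z₁ - 1, `e₁` turns this into z (1 - z₂), and
          -- the σ-conjugate of `e₁` into z z₁ z₃. The solver step records the corresponding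
          -- combination of the three relations.
          γ₂′ : σ (σ γ) ≡ α ⊗ α₁ ⊗ α₂ ⊗ (z ⊗ z₁ ⊗ z₃)
          γ₂′ = begin
            σ (σ γ)                                 ≡⟨ γ₂ ⟩
            σ w ⊗ z ⊗ z₁ ⊗ α ⊗ α₁ ⊗ α₂
              ≡⟨ solve 8 (λ a a₁ a₂ z z₁ z₂ z₃ w → w :* z :* z₁ :* a :* a₁ :* a₂
                   := a :* a₁ :* a₂ :* (z :* z₁ :* z₃ :- z :* (z₃ :* z₁ :+ z₂ :- i) :+ (z₂ :* z :+ z₁ :- i) :- (z₁ :+ z :- i :- w :* (z :* z₁))))
                   refl α α₁ α₂ z z₁ z₂ z₃ (σ w) ⟩
            α ⊗ α₁ ⊗ α₂ ⊗ (z ⊗ z₁ ⊗ z₃ ⊕ ⊖ (z ⊗ (z₃ ⊗ z₁ ⊕ z₂ ⊕ ⊖ 1#)) ⊕ e₁ ⊕ ⊖ e₂)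
              ≡⟨ cong (α ⊗ α₁ ⊗ α₂ ⊗_) (trans (cong₂ (λ u v → z ⊗ z₁ ⊗ z₃ ⊕ ⊖ (z ⊗ u) ⊕ v ⊕ ⊖ e₂) σe₁≡0 e₁≡0)
                  (cong (λ u → z ⊗ z₁ ⊗ z₃ ⊕ ⊖ (z ⊗ 0#) ⊕ 0# ⊕ ⊖ u) e₂≡0)) ⟩
            α ⊗ α₁ ⊗ α₂ ⊗ (z ⊗ z₁ ⊗ z₃ ⊕ ⊖ (z ⊗ 0#) ⊕ 0# ⊕ ⊖ 0#)
              ≡⟨ solve 3 (λ a z u → a :* (u :- z :* o :+ o :- o) := a :* u) refl (α ⊗ α₁ ⊗ α₂) z (z ⊗ z₁ ⊗ z₃) ⟩
            α ⊗ α₁ ⊗ α₂ ⊗ (z ⊗ z₁ ⊗ z₃)             ∎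
            where
            open ≡-Reasoning
            i o : ∀ {n} → Polynomial n
            i = con (+ 1)
            o = con (+ 0)

          -- By `e₁` the factor 1 - z₁ in `r₀` equals z z₂.
          r₀≡ : r₀ ≡ ⊖ (α₁ ⊗ α₂ ⊗ (z ⊗ z₂) ⊗ γ)
          r₀≡ = begin
            r₀                                                      ≡⟨ cong (λ u → ⊖ ((α₂ ⊗ α₁ ⊕ ⊖ u) ⊗ γ)) β₂ ⟩
            ⊖ ((α₂ ⊗ α₁ ⊕ ⊖ (z₁ ⊗ (α₁ ⊗ α₂))) ⊗ γ)
              ≡⟨ solve 6 (λ a₁ a₂ z z₁ z₂ g → :- ((a₂ :* a₁ :- z₁ :* (a₁ :* a₂)) :* g)
                   := :- (a₁ :* a₂ :* (z :* z₂) :* g) :+ a₁ :* a₂ :* g :* (z₂ :* z :+ z₁ :- con (+ 1))) refl α₁ α₂ z z₁ z₂ γ ⟩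
            ⊖ (α₁ ⊗ α₂ ⊗ (z ⊗ z₂) ⊗ γ) ⊕ α₁ ⊗ α₂ ⊗ γ ⊗ e₁
              ≡⟨ cong (λ u → ⊖ (α₁ ⊗ α₂ ⊗ (z ⊗ z₂) ⊗ γ) ⊕ α₁ ⊗ α₂ ⊗ γ ⊗ u) e₁≡0 ⟩
            ⊖ (α₁ ⊗ α₂ ⊗ (z ⊗ z₂) ⊗ γ) ⊕ α₁ ⊗ α₂ ⊗ γ ⊗ 0#           ≡⟨ solve 2 (λ u v → u :+ v :* con (+ 0) := u) refl _ _ ⟩
            ⊖ (α₁ ⊗ α₂ ⊗ (z ⊗ z₂) ⊗ γ)                              ∎
            where open ≡-Reasoning

          -- Shifting by σ² brings γ into the form covered by `γ₂′`. Then each of the five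
          -- conjugates of z and of α occurs exactly once, and the resulting norms are themselves
          -- fixed by σ.
          r₀≡-norm : r₀ ≡ ⊖ (norm z ⊗ norm α)
          r₀≡-norm = σ-injective (σ-injective (begin
            σ (σ r₀)                                       ≡⟨ cong (σ ∘ σ) r₀≡ ⟩
            σ (σ (⊖ (α₁ ⊗ α₂ ⊗ (z ⊗ z₂) ⊗ γ)))             ≡⟨ cong σ (trans (σ-⊖ _) (cong ⊖_ (σ-⁵ α₁ α₂ z z₂ γ))) ⟩
            σ (⊖ (α₂ ⊗ α₃ ⊗ (z₁ ⊗ z₃) ⊗ σ γ))              ≡⟨ trans (σ-⊖ _) (cong ⊖_ (σ-⁵ α₂ α₃ z₁ z₃ (σ γ))) ⟩
            ⊖ (α₃ ⊗ α₄ ⊗ (z₂ ⊗ z₄) ⊗ σ (σ γ))              ≡⟨ cong (λ u → ⊖ (α₃ ⊗ α₄ ⊗ (z₂ ⊗ z₄) ⊗ u)) γ₂′ ⟩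
            ⊖ (α₃ ⊗ α₄ ⊗ (z₂ ⊗ z₄) ⊗ (α ⊗ α₁ ⊗ α₂ ⊗ (z ⊗ z₁ ⊗ z₃)))
              ≡⟨ solve 10 (λ a b c d e s t u v w → :- (d :* e :* (u :* w) :* (a :* b :* c :* (s :* t :* v)))
                   := :- (s :* t :* u :* v :* w :* (a :* b :* c :* d :* e))) refl α α₁ α₂ α₃ α₄ z z₁ z₂ z₃ z₄ ⟩
            ⊖ (norm z ⊗ norm α)                            ≡⟨ cong ⊖_ (cong₂ _⊗_ (σ-norm z) (σ-norm α)) ⟨
            ⊖ (σ (norm z) ⊗ σ (norm α))                    ≡⟨ trans (cong ⊖_ (sym (σ-⊗ _ _))) (sym (σ-⊖ _)) ⟩
            σ (⊖ (norm z ⊗ norm α))                        ≡⟨ cong (λ u → σ (⊖ u)) (cong₂ _⊗_ (σ-norm z) (σ-norm α)) ⟨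
            σ (⊖ (σ (norm z) ⊗ σ (norm α)))                ≡⟨ cong σ (trans (cong ⊖_ (sym (σ-⊗ _ _))) (sym (σ-⊖ _))) ⟩
            σ (σ (⊖ (norm z ⊗ norm α)))                    ∎))
            where
            open ≡-Reasoning
            σ-⁵ : ∀ a b c d e → σ (a ⊗ b ⊗ (c ⊗ d) ⊗ e) ≡ σ a ⊗ σ b ⊗ (σ c ⊗ σ d) ⊗ σ e
            σ-⁵ a b c d e = trans (σ-⊗ _ _) (cong (_⊗ σ e) (trans (σ-⊗ _ _) (cong₂ _⊗_ (σ-⊗ _ _) (σ-⊗ _ _))))

          -- At z = 0 the expression `e₁` would be -1.
          z≢0 : z ≢ 0#
          z≢0 z≡0 = 0≢1 (sym (begin
            1#                            ≡⟨ solve 0 (con (+ 1) := :- (con (+ 0) :+ con (+ 0) :- con (+ 1))) refl ⟩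
            ⊖ (0# ⊕ 0# ⊕ ⊖ 1#)
              ≡⟨ cong₂ (λ u v → ⊖ (u ⊕ v ⊕ ⊖ 1#)) (trans (cong (z₂ ⊗_) z≡0) (zeroʳ z₂)) (trans (cong σ z≡0) σ-0) ⟨
            ⊖ e₁                          ≡⟨ cong ⊖_ e₁≡0 ⟩
            ⊖ 0#                          ≡⟨ solve 0 (:- con (+ 0) := con (+ 0)) refl ⟩
            0#                            ∎))
            where open ≡-Reasoning

          remainder≡0 : ∀ {c} → r₀ ≡ c → All (_≡ 0#) (remainder c)
          remainder≡0 {c} r₀≡c = trans (cong (_⊕ ⊖ c) r₀≡c) (-‿inverseʳ c) ∷ proj₁ r≡0 ∷ proj₂ r≡0 ∷ []
            where r≡0 = e≡0⇒r≡0 e₁≡0 e₂≡0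

        -- The twist is θ = -zα: its norm is -N(z)N(α) = `r₀`, so `remainder (norm θ)` vanishes.
        count-roots⇔ : (count (λ y → proj ℓ y ≟ 0#) ≡ q ^ 2 + q + 1) ⇔ (e₁ ≡ 0# × e₂ ≡ 0#)
        count-roots⇔ = mk⇔
          (λ full → let r₁≡r₂≡0 = count-roots⇒r₁≡r₂≡0 γ≢0 full in r≡0⇒e≡0 (proj₁ r₁≡r₂≡0) (proj₂ r₁≡r₂≡0))
          (λ (e₁≡0 , e₂≡0) → remainder≡0⇒count-roots (⊖ (z ⊗ α)) (⊖-≢0 (⊗-≢0 (z≢0 e₁≡0 e₂≡0) α≢0))
            (remainder≡0 e₁≡0 e₂≡0 (trans (r₀≡-norm e₁≡0 e₂≡0) (sym (trans (norm-⊖ (z ⊗ α)) (cong ⊖_ (norm-⊗ z α)))))))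

        -- Here θ = 1 and c = 1, so the constant coefficient adds the condition `r₀` = 1, that is
        -- N(z)N(α) = -1.
        count-kernel⇔ : (count (kernel (eval 1# ℓ)) ≡ q ^ 3) ⇔ (e₁ ≡ 0# × e₂ ≡ 0# × norm z ⊗ norm α ≡ ⊖ 1#)
        count-kernel⇔ = mk⇔ (necessary ∘ count-kernel⇒remainder≡0) sufficient
          where
          necessary : All (_≡ 0#) (remainder 1#) → e₁ ≡ 0# × e₂ ≡ 0# × norm z ⊗ norm α ≡ ⊖ 1#
          necessary (r₀-1≡0 ∷ r₁≡0 ∷ r₂≡0 ∷ []) = e₁≡0 , e₂≡0 ,
            trans (sym (⊖-involutive _)) (cong ⊖_ (trans (sym (r₀≡-norm e₁≡0 e₂≡0)) (⊕-cancel-≡0 r₀-1≡0)))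
            where
            e₁≡0 = proj₁ (r≡0⇒e≡0 r₁≡0 r₂≡0)
            e₂≡0 = proj₂ (r≡0⇒e≡0 r₁≡0 r₂≡0)
          sufficient : e₁ ≡ 0# × e₂ ≡ 0# × norm z ⊗ norm α ≡ ⊖ 1# → count (kernel (eval 1# ℓ)) ≡ q ^ 3
          sufficient (e₁≡0 , e₂≡0 , Nzα≡-1) = remainder≡0⇒count-kernel 1# (0≢1 ∘ sym)
            (remainder≡0 e₁≡0 e₂≡0 (trans (r₀≡-norm e₁≡0 e₂≡0) (trans (cong ⊖_ Nzα≡-1) (trans (⊖-involutive 1#) (sym norm-1)))))

-- Generators of the Galois group as powers of Frobenius

module FrobeniusPower (F : FiniteField) where
  open FiniteField F
  open Field F
  open Counting F
  open AdditiveMaps F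
  open ≡-Reasoning

  module _ (q : ℕ) (2≤q : 2 ≤ q) (size≡q^5 : size ≡ q ^ 5) (q-additive : Additive q)
    (s : ℕ) (1≤s : 1 ≤ s) (s≤4 : s ≤ 4) where

    -- The exponent is `s * 1` rather than `s` so that `σ x` agrees by computation with the power
    -- x^σ of the theorem.
    σ : Carrier → Carrier
    σ x = x ** (q ^ (s * 1))

    σ-⊕ : ∀ x y → σ (x ⊕ y) ≡ σ x ⊕ σ y
    σ-⊕ = additive-^ q-additive (s * 1)

    σ-⊗ : ∀ x y → σ (x ⊗ y) ≡ σ x ⊗ σ y
    σ-⊗ x y = **-distrib-⊗ x y (q ^ (s * 1))

    **-fixed-^ : ∀ {x} n m → x ** n ≡ x → x ** (n ^ m) ≡ x
    **-fixed-^ n zero    fixed = *-identityʳ _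
    **-fixed-^ {x} n (suc m) fixed = trans (sym (**-assoc x n (n ^ m))) (trans (cong (_** (n ^ m)) fixed) (**-fixed-^ n m fixed))

    **-q^5 : ∀ x m → x ** (q ^ (5 * m)) ≡ x
    **-q^5 x m = trans (cong (x **_) (sym (ℕ.^-*-assoc q 5 m))) (**-fixed-^ (q ^ 5) m (subst (λ n → x ** n ≡ x) size≡q^5 (fermat x)))

    -- Fermat's theorem for q⁵ elements: the exponent of q matters only modulo 5.
    **-q^-mod-5 : ∀ x i m → x ** (q ^ (i + 5 * m)) ≡ x ** (q ^ i)
    **-q^-mod-5 x i m = begin
      x ** (q ^ (i + 5 * m))            ≡⟨ cong (x **_) (ℕ.^-distribˡ-+-* q i (5 * m)) ⟩
      x ** (q ^ i * q ^ (5 * m))        ≡⟨ **-assoc x (q ^ i) (q ^ (5 * m)) ⟨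
      (x ** (q ^ i)) ** (q ^ (5 * m))   ≡⟨ **-q^5 _ m ⟩
      x ** (q ^ i)                      ∎

    σ-** : ∀ x i → σ (x ** (q ^ (s * i))) ≡ x ** (q ^ (s * suc i))
    σ-** x i = begin
      (x ** (q ^ (s * i))) ** (q ^ (s * 1))   ≡⟨ **-assoc x (q ^ (s * i)) (q ^ (s * 1)) ⟩
      x ** (q ^ (s * i) * q ^ (s * 1))        ≡⟨ cong (x **_) (ℕ.^-distribˡ-+-* q (s * i) (s * 1)) ⟨
      x ** (q ^ (s * i + s * 1))              ≡⟨ cong (λ n → x ** (q ^ n)) (ℕ.*-distribˡ-+ s i 1) ⟨
      x ** (q ^ (s * (i + 1)))                ≡⟨ cong (λ n → x ** (q ^ (s * n))) (ℕ.+-comm i 1) ⟩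
      x ** (q ^ (s * suc i))                  ∎

    σ² : ∀ x → σ (σ x) ≡ x ** (q ^ (s * 2))
    σ² x = σ-** x 1
    σ³ : ∀ x → σ (σ (σ x)) ≡ x ** (q ^ (s * 3))
    σ³ x = trans (cong σ (σ² x)) (σ-** x 2)
    σ⁴ : ∀ x → σ (σ (σ (σ x))) ≡ x ** (q ^ (s * 4))
    σ⁴ x = trans (cong σ (σ³ x)) (σ-** x 3)
    σ⁵ : ∀ x → σ (σ (σ (σ (σ x)))) ≡ x
    σ⁵ x = trans (cong σ (σ⁴ x)) (trans (σ-** x 4) (trans (cong (λ n → x ** (q ^ n)) (ℕ.*-comm s 5)) (**-q^5 x s)))

    inverse-mod-5 : ∀ s → 1 ≤ s → s ≤ 4 → ∃ λ u → ∃ λ m → s * 1 * u ≡ 1 + 5 * m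
    inverse-mod-5 1 _ _ = 1 , 0 , refl
    inverse-mod-5 2 _ _ = 3 , 1 , refl
    inverse-mod-5 3 _ _ = 2 , 1 , refl
    inverse-mod-5 4 _ _ = 4 , 3 , refl
    inverse-mod-5 (suc (suc (suc (suc (suc _))))) _ (s≤s (s≤s (s≤s (s≤s ()))))

    -- This is where σ generates the Galois group: s is a unit modulo 5, and for s u = 1 + 5m the
    -- power σ^u is the q-Frobenius.
    σ-fixed⇒**q-fixed : ∀ x → σ x ≡ x → x ** q ≡ x
    σ-fixed⇒**q-fixed x fixed = let u , m , su≡1+5m = inverse-mod-5 s 1≤s s≤4 in begin
      x ** q                       ≡⟨ cong (x **_) (ℕ.*-identityʳ q) ⟨
      x ** (q ^ 1)                 ≡⟨ **-q^-mod-5 x 1 m ⟨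
      x ** (q ^ (1 + 5 * m))       ≡⟨ cong (λ n → x ** (q ^ n)) su≡1+5m ⟨
      x ** (q ^ (s * 1 * u))       ≡⟨ cong (x **_) (ℕ.^-*-assoc q (s * 1) u) ⟨
      x ** ((q ^ (s * 1)) ^ u)     ≡⟨ **-fixed-^ (q ^ (s * 1)) u fixed ⟩
      x                            ∎

    count-σ-fixed : count (λ x → σ x ≟ x) ≤ q
    count-σ-fixed = ℕ.≤-trans (count-mono (λ x → σ x ≟ x) (λ x → (x ** q) ≟ x) σ-fixed⇒**q-fixed)
      (PlainPolynomials.count-fixed-≤ F q 2≤q)

    r : ℕ
    r = ℕ.pred q

    1+r≡q : suc r ≡ q
    1+r≡q = ℕ.suc-pred q {{ℕ.>-nonZero (ℕ.<-trans (s≤s z≤n) 2≤q)}}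

    0<r : 0 < r
    0<r = ℕ.s≤s⁻¹ (ℕ.≤-trans 2≤q (ℕ.≤-reflexive (sym 1+r≡q)))

    size≡[1+r]^5 : size ≡ suc r ^ 5
    size≡[1+r]^5 = trans size≡q^5 (cong (_^ 5) (sym 1+r≡q))

    count-σ-fixed′ : count (λ x → σ x ≟ x) ≤ suc r
    count-σ-fixed′ = ℕ.≤-trans count-σ-fixed (ℕ.≤-reflexive (sym 1+r≡q))

    open SkewPolynomials.Semilinear F σ σ-⊕ σ-⊗ (1**n≡1 (q ^ (s * 1))) σ⁵ r 0<r size≡[1+r]^5 count-σ-fixed′
      hiding (q)

    -- As s is invertible modulo 5, the exponents 0, s, 2s, 3s, 4s represent all residues modulo 5.
    norm-** : ∀ x → norm x ≡ x ** (1 + q + q ^ 2 + q ^ 3 + q ^ 4)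
    norm-** x = begin
      norm x              ≡⟨ cong₂ _⊗_ (cong₂ _⊗_ (cong (x ⊗ σ x ⊗_) (σ² x)) (σ³ x)) (σ⁴ x) ⟩
      x ⊗ x ** (q ^ (s * 1)) ⊗ x ** (q ^ (s * 2)) ⊗ x ** (q ^ (s * 3)) ⊗ x ** (q ^ (s * 4))
                          ≡⟨ permute s 1≤s s≤4 ⟩
      x ⊗ φ 1 ⊗ φ 2 ⊗ φ 3 ⊗ φ 4
                          ≡⟨ cong₂ (λ u v → u ⊗ v ⊗ φ 2 ⊗ φ 3 ⊗ φ 4) (sym (*-identityʳ x)) (cong (x **_) (ℕ.*-identityʳ q)) ⟩
      x ** 1 ⊗ x ** q ⊗ φ 2 ⊗ φ 3 ⊗ φ 4
                          ≡⟨ cong (λ u → u ⊗ φ 2 ⊗ φ 3 ⊗ φ 4) (**-homo-+ x 1 q) ⟨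
      x ** (1 + q) ⊗ φ 2 ⊗ φ 3 ⊗ φ 4
                          ≡⟨ cong (λ u → u ⊗ φ 3 ⊗ φ 4) (**-homo-+ x (1 + q) (q ^ 2)) ⟨
      x ** (1 + q + q ^ 2) ⊗ φ 3 ⊗ φ 4
                          ≡⟨ cong (_⊗ φ 4) (**-homo-+ x (1 + q + q ^ 2) (q ^ 3)) ⟨
      x ** (1 + q + q ^ 2 + q ^ 3) ⊗ φ 4
                          ≡⟨ **-homo-+ x (1 + q + q ^ 2 + q ^ 3) (q ^ 4) ⟨
      x ** (1 + q + q ^ 2 + q ^ 3 + q ^ 4) ∎
      where
      φ : ℕ → Carrier
      φ i = x ** (q ^ i)
      cong₄ : ∀ {a a′ b b′ c c′ d d′} → a ≡ a′ → b ≡ b′ → c ≡ c′ → d ≡ d′ → x ⊗ a ⊗ b ⊗ c ⊗ d ≡ x ⊗ a′ ⊗ b′ ⊗ c′ ⊗ d′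
      cong₄ refl refl refl refl = refl
      permute : ∀ s → 1 ≤ s → s ≤ 4 → x ⊗ φ (s * 1) ⊗ φ (s * 2) ⊗ φ (s * 3) ⊗ φ (s * 4) ≡ x ⊗ φ 1 ⊗ φ 2 ⊗ φ 3 ⊗ φ 4
      permute 1 _ _ = refl
      permute 2 _ _ = trans
        (cong₄ {φ 2} {φ 2} {φ 4} {φ 4} refl refl (**-q^-mod-5 x 1 1) (**-q^-mod-5 x 3 1))
        (solve 5 (λ x a b c d → x :* b :* d :* a :* c := x :* a :* b :* c :* d) refl x (φ 1) (φ 2) (φ 3) (φ 4))
      permute 3 _ _ = trans
        (cong₄ {φ 3} {φ 3} refl (**-q^-mod-5 x 1 1) (**-q^-mod-5 x 4 1) (**-q^-mod-5 x 2 2))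
        (solve 5 (λ x a b c d → x :* c :* a :* d :* b := x :* a :* b :* c :* d) refl x (φ 1) (φ 2) (φ 3) (φ 4))
      permute 4 _ _ = trans
        (cong₄ {φ 4} {φ 4} refl (**-q^-mod-5 x 3 1) (**-q^-mod-5 x 2 2) (**-q^-mod-5 x 1 3))
        (solve 5 (λ x a b c d → x :* d :* c :* b :* a := x :* a :* b :* c :* d) refl x (φ 1) (φ 2) (φ 3) (φ 4))
      permute (suc (suc (suc (suc (suc _))))) _ (s≤s (s≤s (s≤s (s≤s ()))))

    **-suc : ∀ x n → x ** (n + 1) ≡ x ** n ⊗ x
    **-suc x n = trans (**-homo-+ x n 1) (cong (x ** n ⊗_) (*-identityʳ x))

    -- From L and P to the monic cubic

    module Quadrinomial (a b c d : Carrier) (abcd≢0 : a ⊗ b ⊗ c ⊗ d ≢ 0#) where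

      Q : ℕ → ℕ
      Q i = q ^ (s * i)
      N L P : Carrier → Carrier
      N x = x ** (1 + q + q ^ 2 + q ^ 3 + q ^ 4)
      L x = (a ⊗ x) ⊕ (b ⊗ (x ** Q 1)) ⊕ (c ⊗ (x ** Q 2)) ⊕ (d ⊗ (x ** Q 3))
      P y = a ⊕ (b ⊗ y) ⊕ (c ⊗ (y ** (Q 1 + 1))) ⊕ (d ⊗ (y ** (Q 2 + Q 1 + 1)))
      w z : Carrier
      w = ((a ** Q 1) ⊗ c) / (b ** (Q 1 + 1))
      z = ((b ** Q 1) ⊗ d) / (c ** (Q 1 + 1))

      abc≢0 : a ⊗ b ⊗ c ≢ 0#
      abc≢0 = ⊗-≢0ˡ abcd≢0
      ab≢0 : a ⊗ b ≢ 0#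
      ab≢0 = ⊗-≢0ˡ abc≢0
      a≢0 : a ≢ 0#
      a≢0 = ⊗-≢0ˡ ab≢0
      b≢0 : b ≢ 0#
      b≢0 = ⊗-≢0ʳ ab≢0
      c≢0 : c ≢ 0#
      c≢0 = ⊗-≢0ʳ abc≢0
      d≢0 : d ≢ 0#
      d≢0 = ⊗-≢0ʳ abcd≢0

      α β γ : Carrier
      α = c / d
      β = b / d
      γ = a / d

      σ-/ : ∀ x → σ (x / d) ⊗ σ d ≡ σ x
      σ-/ x = trans (sym (**-distrib-⊗ (x / d) d (Q 1))) (cong σ (/-⊗ d≢0))

      -- Multiplying by d σ(d) clears the denominators of α, β and σ(α), σ(β): z does not change
      -- when L is scaled. The same holds for w in `w-def`.
      z-def : z ⊗ (α ⊗ σ α) ≡ σ β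
      z-def = ⊗-cancelˡ (⊗-≢0 d≢0 (σ-≢0 d≢0)) (begin
        d ⊗ σ d ⊗ (z ⊗ (α ⊗ σ α))
          ≡⟨ solve 5 (λ d d₁ z u v → d :* d₁ :* (z :* (u :* v)) := z :* (v :* d₁ :* (u :* d))) refl d (σ d) z α (σ α) ⟩
        z ⊗ (σ α ⊗ σ d ⊗ (α ⊗ d))      ≡⟨ cong (z ⊗_) (trans (cong₂ _⊗_ (σ-/ c) (/-⊗ d≢0)) (sym (**-suc c (Q 1)))) ⟩
        z ⊗ c ** (Q 1 + 1)             ≡⟨ /-⊗ (λ eq → c≢0 (**-≡0 (Q 1 + 1) eq)) ⟩
        σ b ⊗ d                        ≡⟨ cong (_⊗ d) (σ-/ b) ⟨
        σ β ⊗ σ d ⊗ d                  ≡⟨ solve 3 (λ x y z → x :* y :* z := z :* y :* x) refl (σ β) (σ d) d ⟩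
        d ⊗ σ d ⊗ σ β                  ∎)

      w-def : w ⊗ (β ⊗ σ β) ≡ σ γ ⊗ α
      w-def = ⊗-cancelˡ (⊗-≢0 d≢0 (σ-≢0 d≢0)) (begin
        d ⊗ σ d ⊗ (w ⊗ (β ⊗ σ β))
          ≡⟨ solve 5 (λ d d₁ z u v → d :* d₁ :* (z :* (u :* v)) := z :* (v :* d₁ :* (u :* d))) refl d (σ d) w β (σ β) ⟩
        w ⊗ (σ β ⊗ σ d ⊗ (β ⊗ d))      ≡⟨ cong (w ⊗_) (trans (cong₂ _⊗_ (σ-/ b) (/-⊗ d≢0)) (sym (**-suc b (Q 1)))) ⟩
        w ⊗ b ** (Q 1 + 1)             ≡⟨ /-⊗ (λ eq → b≢0 (**-≡0 (Q 1 + 1) eq)) ⟩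
        σ a ⊗ c                        ≡⟨ cong₂ _⊗_ (σ-/ a) (/-⊗ d≢0) ⟨
        σ γ ⊗ σ d ⊗ (α ⊗ d)
          ≡⟨ solve 4 (λ x y z t → x :* y :* (z :* t) := t :* y :* (x :* z)) refl (σ γ) (σ d) α d ⟩
        d ⊗ σ d ⊗ (σ γ ⊗ α)            ∎)

      open Cubic α β γ
      open Invariants (/-≢0 c≢0 d≢0) (/-≢0 a≢0 d≢0) z w z-def w-def

      e₁≡ : (z ** (Q 2 + 1)) ⊕ (z ** Q 1) ⊕ (⊖ 1#) ≡ e₁
      e₁≡ = cong (λ u → u ⊕ σ z ⊕ ⊖ 1#) (trans (**-suc z (Q 2)) (cong (_⊗ z) (sym (σ² z))))

      e₃≡ : N z ⊗ N (c / d) ≡ norm z ⊗ norm α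
      e₃≡ = sym (cong₂ _⊗_ (norm-** z) (norm-** α))

      L≡ : ∀ x → L x ≡ d ⊗ eval 1# ℓ x
      L≡ x = begin
        a ⊗ x ⊕ b ⊗ σ x ⊕ c ⊗ x ** Q 2 ⊕ d ⊗ x ** Q 3
          ≡⟨ cong₂ (λ u v → a ⊗ x ⊕ b ⊗ σ x ⊕ c ⊗ u ⊕ d ⊗ v) (σ² x) (σ³ x) ⟨
        a ⊗ x ⊕ b ⊗ σ x ⊕ c ⊗ σ (σ x) ⊕ d ⊗ σ (σ (σ x))
          ≡⟨ cong₂ (λ u v → u ⊗ x ⊕ v ⊗ σ x ⊕ c ⊗ σ (σ x) ⊕ d ⊗ σ (σ (σ x))) (/-⊗ d≢0) (/-⊗ d≢0) ⟨
        γ ⊗ d ⊗ x ⊕ β ⊗ d ⊗ σ x ⊕ c ⊗ σ (σ x) ⊕ d ⊗ σ (σ (σ x))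
          ≡⟨ cong (λ u → γ ⊗ d ⊗ x ⊕ β ⊗ d ⊗ σ x ⊕ u ⊗ σ (σ x) ⊕ d ⊗ σ (σ (σ x))) (/-⊗ d≢0) ⟨
        γ ⊗ d ⊗ x ⊕ β ⊗ d ⊗ σ x ⊕ α ⊗ d ⊗ σ (σ x) ⊕ d ⊗ σ (σ (σ x))
          ≡⟨ solve 8 (λ d g b a x x₁ x₂ x₃ → g :* d :* x :+ b :* d :* x₁ :+ a :* d :* x₂ :+ d :* x₃
               := d :* (g :* x :+ (b :* x₁ :+ (a :* x₂ :+ (con (+ 1) :* x₃ :+ con (+ 0)))))) refl d γ β α x (σ x) (σ (σ x)) (σ (σ (σ x))) ⟩
        d ⊗ (γ ⊗ x ⊕ (β ⊗ σ x ⊕ (α ⊗ σ (σ x) ⊕ (1# ⊗ σ (σ (σ x)) ⊕ 0#))))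
          ≡⟨ cong (λ u → d ⊗ (γ ⊗ x ⊕ u)) (cong₂ _⊕_ (cong (β ⊗_) τ¹) (cong₂ (λ u v → α ⊗ u ⊕ (1# ⊗ v ⊕ 0#)) τ² τ³)) ⟨
        d ⊗ eval 1# ℓ x ∎
        where
        τ : Carrier → Carrier
        τ x = 1# ⊗ σ x
        τ¹ : τ x ≡ σ x
        τ¹ = *-identityˡ (σ x)
        τ² : τ (τ x) ≡ σ (σ x)
        τ² = trans (*-identityˡ _) (cong σ τ¹)
        τ³ : τ (τ (τ x)) ≡ σ (σ (σ x))
        τ³ = trans (*-identityˡ _) (cong σ τ²)

      P≡ : ∀ y → P y ≡ d ⊗ proj ℓ y
      P≡ y = begin
        a ⊕ b ⊗ y ⊕ c ⊗ y ** (Q 1 + 1) ⊕ d ⊗ y ** (Q 2 + Q 1 + 1)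
          ≡⟨ cong₂ (λ u v → a ⊕ b ⊗ y ⊕ c ⊗ u ⊕ d ⊗ v) (**-suc y (Q 1))
               (trans (**-suc y (Q 2 + Q 1)) (cong (_⊗ y) (trans (**-homo-+ y (Q 2) (Q 1)) (cong (_⊗ σ y) (sym (σ² y)))))) ⟩
        a ⊕ b ⊗ y ⊕ c ⊗ (σ y ⊗ y) ⊕ d ⊗ (σ (σ y) ⊗ σ y ⊗ y)
          ≡⟨ cong₂ (λ u v → u ⊕ v ⊗ y ⊕ c ⊗ (σ y ⊗ y) ⊕ d ⊗ (σ (σ y) ⊗ σ y ⊗ y)) (/-⊗ d≢0) (/-⊗ d≢0) ⟨
        γ ⊗ d ⊕ β ⊗ d ⊗ y ⊕ c ⊗ (σ y ⊗ y) ⊕ d ⊗ (σ (σ y) ⊗ σ y ⊗ y)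
          ≡⟨ cong (λ u → γ ⊗ d ⊕ β ⊗ d ⊗ y ⊕ u ⊗ (σ y ⊗ y) ⊕ d ⊗ (σ (σ y) ⊗ σ y ⊗ y)) (/-⊗ d≢0) ⟨
        γ ⊗ d ⊕ β ⊗ d ⊗ y ⊕ α ⊗ d ⊗ (σ y ⊗ y) ⊕ d ⊗ (σ (σ y) ⊗ σ y ⊗ y)
          ≡⟨ solve 8 (λ d g b a y y₁ y₂ y₃ → g :* d :+ b :* d :* y :+ a :* d :* (y₁ :* y) :+ d :* (y₂ :* y₁ :* y)
               := d :* (g :+ y :* (b :+ y₁ :* (a :+ y₂ :* (con (+ 1) :+ y₃ :* con (+ 0)))))) refl d γ β α y (σ y) (σ (σ y)) (σ (σ (σ y))) ⟩
        d ⊗ proj ℓ y ∎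

      numRoots-d⊗ : ∀ f g → (∀ x → f x ≡ d ⊗ g x) → numRoots f ≡ count (kernel g)
      numRoots-d⊗ f g f≡dg = trans (numRoots≡count f) (count-cong (kernel f) (kernel g)
        (λ x fx≡0 → ⊗-≡0 d≢0 (trans (sym (f≡dg x)) fx≡0))
        (λ x gx≡0 → trans (f≡dg x) (trans (cong (d ⊗_) gx≡0) (zeroʳ d))))

      E₁ E₂ E₃ : Set
      E₁ = (z ** (Q 2 + 1)) ⊕ (z ** Q 1) ⊕ (⊖ 1#) ≡ 0#
      E₂ = (z ** Q 1) ⊕ z ⊕ (⊖ 1#) ⊕ (⊖ ((w ** Q 1) ⊗ (z ** (1 + Q 1)))) ≡ 0#
      E₃ = N z ⊗ N (c / d) ≡ ⊖ 1#

      numRoots-P⇔ : (numRoots P ≡ q ^ 2 + q + 1) ⇔ (E₁ × E₂)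
      numRoots-P⇔ = mk⇔ necessary sufficient
        where
        roots≡ : suc r ^ 2 + suc r + 1 ≡ q ^ 2 + q + 1
        roots≡ = cong (λ n → n ^ 2 + n + 1) 1+r≡q
        count-P : numRoots P ≡ count (λ y → proj ℓ y ≟ 0#)
        count-P = numRoots-d⊗ P (proj ℓ) P≡
        necessary : numRoots P ≡ q ^ 2 + q + 1 → E₁ × E₂
        necessary full = trans e₁≡ (proj₁ e≡0) , proj₂ e≡0
          where
          e≡0 : e₁ ≡ 0# × e₂ ≡ 0#
          e≡0 = Equivalence.to count-roots⇔ (trans (sym count-P) (trans full (sym roots≡)))
        sufficient : E₁ × E₂ → numRoots P ≡ q ^ 2 + q + 1
        sufficient (E₁ , E₂) = trans count-P (trans (Equivalence.from count-roots⇔ (trans (sym e₁≡) E₁ , E₂)) roots≡)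

      numRoots-L⇔ : (numRoots L ≡ q ^ 3) ⇔ (E₁ × E₂ × E₃)
      numRoots-L⇔ = mk⇔ necessary sufficient
        where
        cube≡ : suc r ^ 3 ≡ q ^ 3
        cube≡ = cong (_^ 3) 1+r≡q
        count-L : numRoots L ≡ count (kernel (eval 1# ℓ))
        count-L = numRoots-d⊗ L (eval 1# ℓ) L≡
        necessary : numRoots L ≡ q ^ 3 → E₁ × E₂ × E₃
        necessary full = trans e₁≡ (proj₁ e≡0) , proj₁ (proj₂ e≡0) , trans e₃≡ (proj₂ (proj₂ e≡0))
          where
          e≡0 : e₁ ≡ 0# × e₂ ≡ 0# × norm z ⊗ norm α ≡ ⊖ 1#
          e≡0 = Equivalence.to count-kernel⇔ (trans (sym count-L) (trans full (sym cube≡)))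
        sufficient : E₁ × E₂ × E₃ → numRoots L ≡ q ^ 3
        sufficient (E₁ , E₂ , E₃) = trans count-L (trans (Equivalence.from count-kernel⇔ (trans (sym e₁≡) E₁ , E₂ , trans (sym e₃≡) E₃)) cube≡)

-- Consequences of q being a prime power

prime-power-≥2 : ∀ p k → Prime p → 1 ≤ k → 2 ≤ p ^ k
prime-power-≥2 p k p-prime 1≤k = ℕ.≤-trans (ℕ.nonTrivial⇒n>1 p {{prime⇒nonTrivial p-prime}})
  (ℕ.≤-trans (ℕ.≤-reflexive (sym (ℕ.^-identityʳ p))) (ℕ.^-monoʳ-≤ p {{prime⇒nonZero p-prime}} 1≤k))

-- The characteristic is `p`: the field size, a power of `p`, kills 1, so a power of `p · 1#` is 0,
-- and a field has no nonzero nilpotents.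
prime-power-additive : ∀ p k → Prime p → (F : FiniteField) → FiniteField.size F ≡ (p ^ k) ^ 5 → Field.Additive F (p ^ k)
prime-power-additive p k p-prime F size≡ = additive-^ (frobenius-additive p-prime p·1≡0) k
  where
  open FiniteField F
  open Field F
  open Algebra.Properties.Semiring.Mult (CommutativeRing.semiring commutativeRing) using () renaming (_×_ to _·_)
  p·1≡0 : p · 1# ≡ 0#
  p·1≡0 = **-≡0 (k * 5) (begin
    (p · 1#) ** (k * 5)      ≡⟨ [^]·1 p (k * 5) ⟨
    (p ^ (k * 5)) · 1#       ≡⟨ cong (_· 1#) (ℕ.^-*-assoc p k 5) ⟨
    ((p ^ k) ^ 5) · 1#       ≡⟨ cong (_· 1#) size≡ ⟨
    size · 1#                ≡⟨ size·1≡0 ⟩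
    0#                       ∎)
    where open ≡-Reasoning

theorem16 : (p k : ℕ) → Prime p → 1 ≤ k →
  (F : FiniteField) → FiniteField.size F ≡ (p ^ k) ^ 5 →
  (s : ℕ) → 1 ≤ s → s ≤ 4 →
  (a b c d : FiniteField.Carrier F) →
  let open FiniteField F
      q = p ^ k
      σ : ℕ → ℕ
      σ i = q ^ (s * i)
      N : Carrier → Carrier
      N x = x ** (1 + q + q ^ 2 + q ^ 3 + q ^ 4)
      w = ((a ** σ 1) ⊗ c) / (b ** (σ 1 + 1))
      z = ((b ** σ 1) ⊗ d) / (c ** (σ 1 + 1))
      L : Carrier → Carrier
      L x = (a ⊗ x) ⊕ (b ⊗ (x ** σ 1)) ⊕ (c ⊗ (x ** σ 2)) ⊕ (d ⊗ (x ** σ 3))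
      P : Carrier → Carrier
      P y = a ⊕ (b ⊗ y) ⊕ (c ⊗ (y ** (σ 1 + 1))) ⊕ (d ⊗ (y ** (σ 2 + σ 1 + 1)))
      E₁ = (z ** (σ 2 + 1)) ⊕ (z ** σ 1) ⊕ (⊖ 1#) ≡ 0#
      E₂ = (z ** σ 1) ⊕ z ⊕ (⊖ 1#) ⊕ (⊖ ((w ** σ 1) ⊗ (z ** (1 + σ 1)))) ≡ 0#
      E₃ = N z ⊗ N (c / d) ≡ ⊖ 1#
  in ¬ (a ⊗ b ⊗ c ⊗ d ≡ 0#) →
     ((numRoots P ≡ q ^ 2 + q + 1) ⇔ (E₁ × E₂))
     × ((numRoots L ≡ q ^ 3) ⇔ (E₁ × E₂ × E₃))
theorem16 p k p-prime 1≤k F size≡ s 1≤s s≤4 a b c d abcd≢0 = numRoots-P⇔ , numRoots-L⇔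
  where
  open FrobeniusPower F
  open Quadrinomial (p ^ k) (prime-power-≥2 p k p-prime 1≤k) size≡ (prime-power-additive p k p-prime F size≡) s 1≤s s≤4 a b c d abcd≢0
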